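{- Let $\eta$ be any joint probability distribution of $(\gamma,s,a)$ supported on $\{(\gamma,s,a):0\le\gamma\le1,\ 0\le s\le a\le1,\ a>0\}$ (with arbitrary correlations among $\gamma,s,a$), put $\lambda:=1/(3a-s)$, and suppose $\mathbb E_\eta[\lambda]<\infty$. For $y\in[0,1]$ define $$F(y):=\mathbb P_\eta[\gamma\le y],\qquad \Psi(y):=\mathbb E_\eta\Bigl[\lambda+\bigl(2-2\lambda\min\{y,a\}\bigr)\mathbf 1_{\{\gamma\le y\}}+2\lambda\,(s-y)_+\Bigr].$$ If $\beta$ is a real number such that $$\Psi(y)\le\beta\quad\text{and}\quad 1-yF(y)\le\beta(1-y)\qquad\text{for all }y\in[0,1],$$ then $$\beta\ge\frac{196969687}{126617839}\approx1.555623509.$$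
   Context: $(b)_+:=\max\{b,0\}$, and $\mathbf 1_A$ is the indicator of the condition $A$. $\mathbb P_\eta,\mathbb E_\eta$ denote probability and expectation under $\eta$. -}

module Defs where

open import Algebra.Bundles using (CommutativeRing)
import Algebra.Construct.NaturalChoice.Max as Max
import Algebra.Construct.NaturalChoice.Min as Min
import Algebra.Definitions.RawMonoid as RawMonoidDefinitions
open import Axiom.ExcludedMiddle using (ExcludedMiddle)
open import Data.Bool.Base using (if_then_else_)
open import Data.Fin.Base using (Fin; toℕ)
open import Data.Nat.Base using (ℕ; zero; suc)
open import Data.Product.Base using (Σ; ∃; _×_; _,_; proj₁)
open import Level using (0ℓ)
open import Relation.Binary.Bundles using (TotalOrder)
open import Relation.Binary.Core using (Rel)
open import Relation.Binary.PropositionalEquality.Core using (_≢_)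
open import Relation.Binary.Structures using (IsTotalOrder)
open import Relation.Nullary.Decidable.Core using (does; yes; no)
open import Relation.Nullary.Negation.Core using (¬_)
open import Relation.Unary using (Pred; _∈_; _≐_; _⊥_; ∁; ⋃; Satisfiable; Universal)

-- The real numbers, characterised up to isomorphism as a Dedekind-complete
-- ordered field.
record CompleteOrderedField : Set₁ where
  infix 4 _≤_ _<_
  infix 8 _⁻¹
  field
    commutativeRing : CommutativeRing 0ℓ 0ℓ

  open CommutativeRing commutativeRing public hiding (zero)

  field
    _≤_          : Rel Carrier 0ℓ
    isTotalOrder : IsTotalOrder _≈_ _≤_
    +-monoˡ-≤    : ∀ z {x y} → x ≤ y → x + z ≤ y + z
    *-nonNeg     : ∀ {x y} → 0# ≤ x → 0# ≤ y → 0# ≤ x * y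
    1≉0          : ¬ 1# ≈ 0#
    -- The value 0# ⁻¹ is unspecified.
    _⁻¹          : Carrier → Carrier
    *-inverseʳ   : ∀ x → ¬ x ≈ 0# → x * x ⁻¹ ≈ 1#

  UpperBound : Pred Carrier 0ℓ → Pred Carrier 0ℓ
  UpperBound P u = ∀ x → x ∈ P → x ≤ u

  BoundedAbove : Pred Carrier 0ℓ → Set
  BoundedAbove P = ∃ (UpperBound P)

  IsSupremum : Pred Carrier 0ℓ → Carrier → Set
  IsSupremum P u = UpperBound P u × (∀ v → UpperBound P v → u ≤ v)

  field
    complete : ∀ P → Satisfiable P → BoundedAbove P → ∃ (IsSupremum P)

  _<_ : Rel Carrier 0ℓ
  x < y = x ≤ y × ¬ x ≈ y

  totalOrder : TotalOrder 0ℓ 0ℓ 0ℓ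
  totalOrder = record { isTotalOrder = isTotalOrder }

  open Min totalOrder public using (_⊓_)
  open Max totalOrder public using (_⊔_)

  _⁺ : Carrier → Carrier
  b ⁺ = b ⊔ 0#

  ∑ : ∀ {n} → (Fin n → Carrier) → Carrier
  ∑ = RawMonoidDefinitions.sum +-rawMonoid

  -- Opaque so that large numerals are never unrolled into sums of 1#.
  opaque
    fromℕ : ℕ → Carrier
    fromℕ zero    = 0#
    fromℕ (suc n) = 1# + fromℕ n

    fromℕ-zero : fromℕ zero ≈ 0#
    fromℕ-zero = refl

    fromℕ-suc : ∀ n → fromℕ (suc n) ≈ 1# + fromℕ n
    fromℕ-suc n = refl

-- Classical probability theory on ℝ³; excluded middle is an explicit parameter.
module Probability (em : ExcludedMiddle 0ℓ) (ℝ : CompleteOrderedField) where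

  open CompleteOrderedField ℝ

  sup : Pred Carrier 0ℓ → Carrier
  sup P with em {Satisfiable P × BoundedAbove P}
  ... | yes (ne , bdd) = proj₁ (complete P ne bdd)
  ... | no _           = 0#

  𝟏[_] : Set → Carrier
  𝟏[ A ] = if does (em {A}) then 1# else 0#

  -- A point (γ , s , a) of ℝ³.
  record Point : Set where
    constructor ⟨_,_,_⟩
    field
      γ s a : Carrier

  open Point public

  -- Codes for the Borel subsets of ℝ³: the σ-algebra generated by the
  -- coordinate half-spaces.  A Borel set is ⟦ A ⟧ for a code A; different codes
  -- may denote the same set.
  data Borel : Set where
    [γ≤_] [s≤_] [a≤_] : Carrier → Borel
    compl             : Borel → Borel
    union             : (ℕ → Borel) → Borel

  ⟦_⟧ : Borel → Pred Point 0ℓ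
  ⟦ [γ≤ t ] ⟧ p = γ p ≤ t
  ⟦ [s≤ t ] ⟧ p = s p ≤ t
  ⟦ [a≤ t ] ⟧ p = a p ≤ t
  ⟦ compl A ⟧   = ∁ ⟦ A ⟧
  ⟦ union A ⟧   = ⋃ ℕ (λ n → ⟦ A n ⟧)

  record ProbabilityMeasure : Set where
    field
      ℙ        : Borel → Carrier
      ℙ-cong   : ∀ A B → ⟦ A ⟧ ≐ ⟦ B ⟧ → ℙ A ≈ ℙ B
      ℙ-nonNeg : ∀ A → 0# ≤ ℙ A
      ℙ-total  : ∀ A → Universal ⟦ A ⟧ → ℙ A ≈ 1#
      -- A series of nonnegative terms sums to the supremum of its partial sums.
      ℙ-union  : ∀ A → (∀ m n → m ≢ n → ⟦ A m ⟧ ⊥ ⟦ A n ⟧) →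
                 IsSupremum (λ r → ∃ λ n → r ≈ ∑ {n} (λ i → ℙ (A (toℕ i))))
                            (ℙ (union A))

  -- A finite Borel partition of ℝ³ together with a lower bound for f on each
  -- cell, i.e. a simple function below f.
  record SimpleBelow (f : Point → Carrier) : Set where
    field
      size     : ℕ
      cell     : Fin size → Borel
      disjoint : ∀ i j → i ≢ j → ⟦ cell i ⟧ ⊥ ⟦ cell j ⟧
      cover    : ∀ p → ∃ λ i → p ∈ ⟦ cell i ⟧
      value    : Fin size → Carrier
      below    : ∀ i p → p ∈ ⟦ cell i ⟧ → value i ≤ f p

  module _ (η : ProbabilityMeasure) where

    open ProbabilityMeasure η

    SupportedOn : Pred Point 0ℓ → Set
    SupportedOn S = ∃ λ A → ⟦ A ⟧ ≐ S × ℙ A ≈ 1#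

    lowerSum : ∀ {f} → SimpleBelow f → Carrier
    lowerSum φ = ∑ (λ i → value i * ℙ (cell i))
      where open SimpleBelow φ

    LowerSums : (Point → Carrier) → Pred Carrier 0ℓ
    LowerSums f r = Σ (SimpleBelow f) λ φ → r ≈ lowerSum φ

    -- The Lebesgue integral: for f ≥ 0 it is the supremum of the lower sums, and
    -- in general the difference of the integrals of the positive and negative
    -- parts.  𝔼 is meaningful only for measurable f with Integrable f.
    Integrable : (Point → Carrier) → Set
    Integrable f = BoundedAbove (LowerSums (λ p → f p ⁺))
                 × BoundedAbove (LowerSums (λ p → (- f p) ⁺))

    𝔼 : (Point → Carrier) → Carrier
    𝔼 f = sup (LowerSums (λ p → f p ⁺)) - sup (LowerSums (λ p → (- f p) ⁺))

  Support : Pred Point 0ℓ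
  Support p = (0# ≤ γ p × γ p ≤ 1#) × (0# ≤ s p × s p ≤ a p × a p ≤ 1#) × 0# < a p

  -- On Support the denominator is positive.
  lam : Point → Carrier
  lam p = (fromℕ 3 * a p - s p) ⁻¹

  F : ProbabilityMeasure → Carrier → Carrier
  F η y = ProbabilityMeasure.ℙ η [γ≤ y ]

  Ψ : ProbabilityMeasure → Carrier → Carrier
  Ψ η y = 𝔼 η λ p →
    lam p + (fromℕ 2 - fromℕ 2 * lam p * (y ⊓ a p)) * 𝟏[ γ p ≤ y ]
          + fromℕ 2 * lam p * (s p - y) ⁺

{-# OPTIONS --safe #-}

-- Weigh the constraints on Ψ at 7/10, 9/10, 1 by 966, 1449, 2898 and those on F at 7/10, 9/10 by
-- 1920, 1960.  The combination is the expectation of a function of (γ, s, a) which is at least 9466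
-- on the support, so 9466 ≤ 6085 β, and 9466 / 6085 exceeds the claimed constant.  The pointwise bound
-- is checked for γ in (-∞, 7/10], (7/10, 9/10] and (9/10, 1] by replacing min {y, a} by y or a, and
-- (s - y)₊ by θ (s - y) with θ in [0, 1]; with u = λ a and λ s = 3 u - 1 everything becomes affine in
-- λ and u.
--
-- Additivity of the integral is avoided: on a partition fine enough in s and a, simple functions below
-- the three integrands of Ψ satisfy the pointwise bound up to a small multiple of the mesh, and the gap
-- between the two constants absorbs this loss.  Cells with a ≤ 1/6, where λ may be unbounded, satisfy
-- the bound merely because λ ≥ 2 there.

module Submission where

open import Defs
import Algebra.Construct.NaturalChoice.Max as Max
import Algebra.Construct.NaturalChoice.Min as Min
import Algebra.Properties.CommutativeMonoid.Sum as CommutativeMonoidSum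
import Algebra.Properties.Ring as RingProperties
import Algebra.Properties.Semiring.Sum as SemiringSum
import Algebra.Solver.Ring as RingSolver
open import Algebra.Solver.Ring.AlmostCommutativeRing
  using (fromCommutativeRing; _-Raw-AlmostCommutative⟶_)
open import Axiom.ExcludedMiddle using (ExcludedMiddle)
open import Data.Fin.Base using (Fin; zero; suc; splitAt; join)
open import Data.Fin.Properties using (splitAt-join; join-splitAt; 0≢1+n; suc-injective)
open import Data.Integer.Base as ℤ using (ℤ; +_; -[1+_]; +-*-rawRing)
import Data.Integer.Properties as ℤ
open import Data.List.Base using (List; []; _∷_; _++_; applyUpTo)
open import Data.List.Membership.Propositional using () renaming (_∈_ to _∈ˡ_)
open import Data.List.Membership.Propositional.Properties using (∈-applyUpTo⁺; ∈-++⁺ˡ; ∈-++⁺ʳ)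
open import Data.List.Relation.Unary.Any using (here; there)
open import Data.Maybe.Base using (Maybe; just; nothing)
open import Data.Nat.Base as ℕ using (ℕ; zero; suc)
import Data.Nat.Properties as ℕ
open import Data.Product.Base using (∃; _×_; _,_; proj₁; proj₂)
open import Data.Sum.Base as Sum using (_⊎_; inj₁; inj₂; [_,_]′)
open import Function.Base using (_∘_)
open import Level using (0ℓ)
open import Relation.Binary.Bundles using (TotalOrder)
open import Relation.Binary.PropositionalEquality.Core as ≡ using (_≡_)
import Relation.Binary.Reasoning.PartialOrder as PartialOrderReasoning
open import Relation.Binary.Structures using (IsTotalOrder)
open import Relation.Nullary.Decidable.Core using (yes; no; decidable-stable)
open import Relation.Nullary.Negation.Core using (¬_; contradiction)
open import Relation.Unary using (Pred; _∈_; _∉_; _⊆_; _⊥_; Empty; Satisfiable)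

-- Ordered-field arithmetic and a ring solver with integer coefficients.

module OrderedField (ℝ : CompleteOrderedField) where

  open CompleteOrderedField ℝ
  open RingProperties ring using (-0#≈0#; -‿involutive; -‿distribˡ-*; -‿distribʳ-*; -‿+-comm)
  open IsTotalOrder isTotalOrder public
    using (antisym; ≤-respˡ-≈; ≤-respʳ-≈)
    renaming (refl to ≤-refl; reflexive to ≤-reflexive; trans to ≤-trans; total to ≤-total)
  open Min totalOrder public using (x⊓y≤x; x⊓y≤y; ⊓-glb)
  open Max totalOrder public using (x≤x⊔y; x≤y⊔x; ⊔-lub)

  module ≤-Reasoning = PartialOrderReasoning (TotalOrder.poset totalOrder)
  open ≤-Reasoning

  -- Sends 0 and 1 to 0# and 1# on the nose, so that the solver below accepts
  -- these constants in place of fromℕ 0 and fromℕ 1.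
  numeral : ℕ → Carrier
  numeral 0             = 0#
  numeral 1             = 1#
  numeral (suc (suc n)) = fromℕ (suc (suc n))

  numeral≈fromℕ : ∀ n → numeral n ≈ fromℕ n
  numeral≈fromℕ 0             = sym fromℕ-zero
  numeral≈fromℕ 1             = begin-equality
    1#             ≈⟨ +-identityʳ 1# ⟨
    1# + 0#        ≈⟨ +-congˡ fromℕ-zero ⟨
    1# + fromℕ 0   ≈⟨ fromℕ-suc 0 ⟨
    fromℕ 1        ∎
  numeral≈fromℕ (suc (suc n)) = refl

  fromℤ : ℤ → Carrier
  fromℤ (+ n)    = numeral n
  fromℤ -[1+ n ] = - numeral (suc n)

  fromℕ-+ : ∀ m n → fromℕ (m ℕ.+ n) ≈ fromℕ m + fromℕ n
  fromℕ-+ zero    n = trans (sym (+-identityˡ _)) (+-congʳ (sym fromℕ-zero))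
  fromℕ-+ (suc m) n = begin-equality
    fromℕ (suc (m ℕ.+ n))       ≈⟨ fromℕ-suc _ ⟩
    1# + fromℕ (m ℕ.+ n)        ≈⟨ +-congˡ (fromℕ-+ m n) ⟩
    1# + (fromℕ m + fromℕ n)    ≈⟨ +-assoc _ _ _ ⟨
    (1# + fromℕ m) + fromℕ n    ≈⟨ +-congʳ (fromℕ-suc m) ⟨
    fromℕ (suc m) + fromℕ n     ∎

  fromℕ-* : ∀ m n → fromℕ (m ℕ.* n) ≈ fromℕ m * fromℕ n
  fromℕ-* zero    n = begin-equality
    fromℕ 0             ≈⟨ fromℕ-zero ⟩
    0#                  ≈⟨ zeroˡ _ ⟨
    0# * fromℕ n        ≈⟨ *-congʳ fromℕ-zero ⟨
    fromℕ 0 * fromℕ n   ∎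
  fromℕ-* (suc m) n = begin-equality
    fromℕ (n ℕ.+ m ℕ.* n)              ≈⟨ fromℕ-+ n _ ⟩
    fromℕ n + fromℕ (m ℕ.* n)          ≈⟨ +-cong (sym (*-identityˡ _)) (fromℕ-* m n) ⟩
    1# * fromℕ n + fromℕ m * fromℕ n   ≈⟨ distribʳ _ _ _ ⟨
    (1# + fromℕ m) * fromℕ n           ≈⟨ *-congʳ (fromℕ-suc m) ⟨
    fromℕ (suc m) * fromℕ n            ∎

  fromℤ-neg : ∀ i → fromℤ (ℤ.- i) ≈ - fromℤ i
  fromℤ-neg (+ 0)             = sym -0#≈0#
  fromℤ-neg (+ suc n)         = refl
  fromℤ-neg -[1+ n ]          = sym (-‿involutive _)

  -- Handles all sums of mixed sign; when both arguments are successors, one `1#` cancels on each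
  -- side.
  fromℤ-⊖ : ∀ m n → fromℤ (m ℤ.⊖ n) ≈ fromℕ m - fromℕ n
  fromℤ-⊖ m zero = begin-equality
    fromℤ (m ℤ.⊖ 0)     ≡⟨ ≡.cong fromℤ (ℤ.⊖-≥ {m} {0} ℕ.z≤n) ⟩
    fromℤ (+ m)         ≈⟨ numeral≈fromℕ m ⟩
    fromℕ m             ≈⟨ +-identityʳ _ ⟨
    fromℕ m + 0#        ≈⟨ +-congˡ (trans (sym -0#≈0#) (-‿cong (sym fromℕ-zero))) ⟩
    fromℕ m - fromℕ 0   ∎
  fromℤ-⊖ zero (suc n) = begin-equality
    - fromℤ (+ suc n)       ≈⟨ -‿cong (numeral≈fromℕ (suc n)) ⟩
    - fromℕ (suc n)         ≈⟨ +-identityˡ _ ⟨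
    0# - fromℕ (suc n)      ≈⟨ +-congʳ fromℕ-zero ⟨
    fromℕ 0 - fromℕ (suc n) ∎
  fromℤ-⊖ (suc m) (suc n) = begin-equality
    fromℤ (suc m ℤ.⊖ suc n)                ≡⟨ ≡.cong fromℤ (ℤ.[1+m]⊖[1+n]≡m⊖n m n) ⟩
    fromℤ (m ℤ.⊖ n)                        ≈⟨ fromℤ-⊖ m n ⟩
    fromℕ m - fromℕ n                      ≈⟨ +-congʳ (+-identityˡ _) ⟨
    0# + fromℕ m - fromℕ n                 ≈⟨ +-congʳ (+-congʳ (-‿inverseʳ 1#)) ⟨
    1# - 1# + fromℕ m - fromℕ n            ≈⟨ +-congʳ (+-assoc _ _ _) ⟩
    1# + (- 1# + fromℕ m) - fromℕ n        ≈⟨ +-congʳ (+-congˡ (+-comm _ _)) ⟩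
    1# + (fromℕ m - 1#) - fromℕ n          ≈⟨ +-congʳ (+-assoc _ _ _) ⟨
    1# + fromℕ m - 1# - fromℕ n            ≈⟨ +-assoc _ _ _ ⟩
    1# + fromℕ m + (- 1# - fromℕ n)        ≈⟨ +-congˡ (-‿+-comm _ _) ⟩
    1# + fromℕ m - (1# + fromℕ n)          ≈⟨ +-cong (fromℕ-suc m) (-‿cong (fromℕ-suc n)) ⟨
    fromℕ (suc m) - fromℕ (suc n)          ∎

  fromℤ-homo-+ : ∀ i j → fromℤ (i ℤ.+ j) ≈ fromℤ i + fromℤ j
  fromℤ-homo-+ (+ m) (+ n) = begin-equality
    fromℤ (+ (m ℕ.+ n))         ≈⟨ numeral≈fromℕ (m ℕ.+ n) ⟩
    fromℕ (m ℕ.+ n)             ≈⟨ fromℕ-+ m n ⟩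
    fromℕ m + fromℕ n           ≈⟨ +-cong (numeral≈fromℕ m) (numeral≈fromℕ n) ⟨
    fromℤ (+ m) + fromℤ (+ n)   ∎
  fromℤ-homo-+ (+ m) -[1+ n ] =
    trans (fromℤ-⊖ m (suc n)) (sym (+-cong (numeral≈fromℕ m) (-‿cong (numeral≈fromℕ (suc n)))))
  fromℤ-homo-+ -[1+ m ] (+ n) = begin-equality
    fromℤ (n ℤ.⊖ suc m)               ≈⟨ fromℤ-⊖ n (suc m) ⟩
    fromℕ n - fromℕ (suc m)           ≈⟨ +-comm _ _ ⟩
    - fromℕ (suc m) + fromℕ n         ≈⟨ +-cong (-‿cong (numeral≈fromℕ (suc m))) (numeral≈fromℕ n) ⟨
    - fromℤ (+ suc m) + fromℤ (+ n)   ∎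
  fromℤ-homo-+ -[1+ m ] -[1+ n ] = begin-equality
    - fromℤ (+ suc (suc (m ℕ.+ n)))         ≡⟨ ≡.cong (λ k → - fromℤ (+ suc k)) (ℕ.+-suc m n) ⟨
    - fromℤ (+ (suc m ℕ.+ suc n))           ≈⟨ -‿cong (fromℤ-homo-+ (+ suc m) (+ suc n)) ⟩
    - (fromℤ (+ suc m) + fromℤ (+ suc n))   ≈⟨ -‿+-comm _ _ ⟨
    - fromℤ (+ suc m) - fromℤ (+ suc n)     ∎

  fromℤ-homo-*⁺ : ∀ m n → fromℤ (+ m ℤ.* + n) ≈ fromℤ (+ m) * fromℤ (+ n)
  fromℤ-homo-*⁺ m n = begin-equality
    fromℤ (+ m ℤ.* + n)         ≡⟨ ≡.cong fromℤ (ℤ.pos-* m n) ⟨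
    fromℤ (+ (m ℕ.* n))         ≈⟨ numeral≈fromℕ (m ℕ.* n) ⟩
    fromℕ (m ℕ.* n)             ≈⟨ fromℕ-* m n ⟩
    fromℕ m * fromℕ n           ≈⟨ *-cong (numeral≈fromℕ m) (numeral≈fromℕ n) ⟨
    fromℤ (+ m) * fromℤ (+ n)   ∎

  fromℤ-homo-*ʳ : ∀ m j → fromℤ (+ m ℤ.* j) ≈ fromℤ (+ m) * fromℤ j
  fromℤ-homo-*ʳ m (+ n)    = fromℤ-homo-*⁺ m n
  fromℤ-homo-*ʳ m -[1+ n ] = begin-equality
    fromℤ (+ m ℤ.* -[1+ n ])           ≡⟨ ≡.cong fromℤ (ℤ.neg-distribʳ-* (+ m) (+ suc n)) ⟨
    fromℤ (ℤ.- (+ m ℤ.* + suc n))      ≈⟨ fromℤ-neg (+ m ℤ.* + suc n) ⟩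
    - fromℤ (+ m ℤ.* + suc n)          ≈⟨ -‿cong (fromℤ-homo-*⁺ m (suc n)) ⟩
    - (fromℤ (+ m) * fromℤ (+ suc n))  ≈⟨ -‿distribʳ-* _ _ ⟩
    fromℤ (+ m) * - fromℤ (+ suc n)    ∎

  fromℤ-homo-* : ∀ i j → fromℤ (i ℤ.* j) ≈ fromℤ i * fromℤ j
  fromℤ-homo-* (+ m)    j = fromℤ-homo-*ʳ m j
  fromℤ-homo-* -[1+ m ] j = begin-equality
    fromℤ (-[1+ m ] ℤ.* j)           ≡⟨ ≡.cong fromℤ (ℤ.neg-distribˡ-* (+ suc m) j) ⟨
    fromℤ (ℤ.- (+ suc m ℤ.* j))      ≈⟨ fromℤ-neg (+ suc m ℤ.* j) ⟩
    - fromℤ (+ suc m ℤ.* j)          ≈⟨ -‿cong (fromℤ-homo-*ʳ (suc m) j) ⟩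
    - (fromℤ (+ suc m) * fromℤ j)    ≈⟨ -‿distribˡ-* _ _ ⟩
    - fromℤ (+ suc m) * fromℤ j      ∎

  fromℤ-morphism : +-*-rawRing -Raw-AlmostCommutative⟶ fromCommutativeRing commutativeRing
  fromℤ-morphism = record
    { ⟦_⟧    = fromℤ
    ; +-homo = fromℤ-homo-+
    ; *-homo = fromℤ-homo-*
    ; -‿homo = fromℤ-neg
    ; 0-homo = refl
    ; 1-homo = refl
    }

  fromℤ-≟ : ∀ i j → Maybe (fromℤ i ≈ fromℤ j)
  fromℤ-≟ i j with i ℤ.≟ j
  ... | yes ≡.refl = just refl
  ... | no  _      = nothing

  module Solver = RingSolver +-*-rawRing (fromCommutativeRing commutativeRing) fromℤ-morphism fromℤ-≟
  open Solver public using (Polynomial; solve; con; _:+_; _:*_; _:-_; :-_; _:=_)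

  infix 10 #_
  #_ : ∀ {n} → ℕ → Polynomial n
  # k = con (+ k)

  -- Order lemmas.

  0≤y-x : ∀ {x y} → x ≤ y → 0# ≤ y - x
  0≤y-x {x} x≤y = ≤-respˡ-≈ (-‿inverseʳ x) (+-monoˡ-≤ (- x) x≤y)

  -- The form in which most inequalities below are proved: the gap is written as an explicit
  -- expression that is visibly nonnegative, and the identity is left to the solver.
  ≤-by : ∀ {x y d} → 0# ≤ d → y ≈ x + d → x ≤ y
  ≤-by {x} {y} {d} 0≤d y≈x+d = begin
    x        ≈⟨ +-identityˡ x ⟨
    0# + x   ≤⟨ +-monoˡ-≤ x 0≤d ⟩
    d + x    ≈⟨ +-comm d x ⟩
    x + d    ≈⟨ y≈x+d ⟨
    y        ∎

  +-nonNeg : ∀ {x y} → 0# ≤ x → 0# ≤ y → 0# ≤ x + y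
  +-nonNeg {x} {y} 0≤x 0≤y = ≤-trans 0≤x (≤-by 0≤y refl)

  +-mono-≤ : ∀ {x y u v} → x ≤ y → u ≤ v → x + u ≤ y + v
  +-mono-≤ {x} {y} {u} {v} x≤y u≤v = ≤-by (+-nonNeg (0≤y-x x≤y) (0≤y-x u≤v))
    (solve 4 (λ x y u v → y :+ v := x :+ u :+ ((y :- x) :+ (v :- u))) refl x y u v)

  *-monoˡ-≤ : ∀ {z x y} → 0# ≤ z → x ≤ y → z * x ≤ z * y
  *-monoˡ-≤ {z} {x} {y} 0≤z x≤y = ≤-by (*-nonNeg 0≤z (0≤y-x x≤y))
    (solve 3 (λ z x y → z :* y := z :* x :+ z :* (y :- x)) refl z x y)

  *-monoʳ-≤ : ∀ {z x y} → 0# ≤ z → x ≤ y → x * z ≤ y * z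
  *-monoʳ-≤ 0≤z x≤y = ≤-respˡ-≈ (*-comm _ _) (≤-respʳ-≈ (*-comm _ _) (*-monoˡ-≤ 0≤z x≤y))

  0≤1 : 0# ≤ 1#
  0≤1 with ≤-total 0# 1#
  ... | inj₁ 0≤1 = 0≤1
  -- Here -1 is nonnegative, hence so is its square, which is 1.
  ... | inj₂ 1≤0 = ≤-respʳ-≈ (solve 0 ((# 0 :- # 1) :* (# 0 :- # 1) := # 1) refl)
                     (*-nonNeg (0≤y-x 1≤0) (0≤y-x 1≤0))

  1≰0 : ¬ 1# ≤ 0#
  1≰0 1≤0 = 1≉0 (antisym 1≤0 0≤1)

  fromℕ-nonNeg : ∀ n → 0# ≤ fromℕ n
  fromℕ-nonNeg zero    = ≤-reflexive (sym fromℕ-zero)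
  fromℕ-nonNeg (suc n) = ≤-respʳ-≈ (sym (fromℕ-suc n)) (+-nonNeg 0≤1 (fromℕ-nonNeg n))

  fromℕ-suc≉0 : ∀ n → ¬ fromℕ (suc n) ≈ 0#
  fromℕ-suc≉0 n n≈0 = 1≰0 (≤-respʳ-≈ n≈0 (≤-by (fromℕ-nonNeg n) (fromℕ-suc n)))

  ⁻¹-nonNeg : ∀ {x} → 0# ≤ x → ¬ x ≈ 0# → 0# ≤ x ⁻¹
  ⁻¹-nonNeg {x} 0≤x x≉0 with ≤-total 0# (x ⁻¹)
  ... | inj₁ 0≤x⁻¹ = 0≤x⁻¹
  ... | inj₂ x⁻¹≤0 = contradiction
    (begin
      1#         ≈⟨ *-inverseʳ x x≉0 ⟨
      x * x ⁻¹   ≤⟨ *-monoˡ-≤ 0≤x x⁻¹≤0 ⟩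
      x * 0#     ≈⟨ zeroʳ x ⟩
      0#         ∎) 1≰0

  *-cancelˡ-≤ : ∀ {z x y} → 0# ≤ z → ¬ z ≈ 0# → z * x ≤ z * y → x ≤ y
  *-cancelˡ-≤ {z} {x} {y} 0≤z z≉0 zx≤zy = begin
    x                ≈⟨ *-identityˡ x ⟨
    1# * x           ≈⟨ *-congʳ z⁻¹z≈1 ⟨
    z ⁻¹ * z * x     ≈⟨ *-assoc _ _ _ ⟩
    z ⁻¹ * (z * x)   ≤⟨ *-monoˡ-≤ (⁻¹-nonNeg 0≤z z≉0) zx≤zy ⟩
    z ⁻¹ * (z * y)   ≈⟨ *-assoc _ _ _ ⟨
    z ⁻¹ * z * y     ≈⟨ *-congʳ z⁻¹z≈1 ⟩
    1# * y           ≈⟨ *-identityˡ y ⟩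
    y                ∎
    where
    z⁻¹z≈1 : z ⁻¹ * z ≈ 1#
    z⁻¹z≈1 = trans (*-comm _ _) (*-inverseʳ z z≉0)

  fromℕ-cancelˡ-≤ : ∀ n {x y} → fromℕ (suc n) * x ≤ fromℕ (suc n) * y → x ≤ y
  fromℕ-cancelˡ-≤ n = *-cancelˡ-≤ (fromℕ-nonNeg (suc n)) (fromℕ-suc≉0 n)

  reciprocal-nonNeg : ∀ n {x} → fromℕ (suc n) * x ≈ 1# → 0# ≤ x
  reciprocal-nonNeg n nx≈1 = fromℕ-cancelˡ-≤ n (≤-respˡ-≈ (sym (zeroʳ _)) (≤-respʳ-≈ (sym nx≈1) 0≤1))

  UnitInterval : Pred Carrier 0ℓ
  UnitInterval x = 0# ≤ x × x ≤ 1#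

  0∈[0,1] : UnitInterval 0#
  0∈[0,1] = ≤-refl , 0≤1

  1∈[0,1] : UnitInterval 1#
  1∈[0,1] = 0≤1 , ≤-refl

  -- The hypothesis makes `x` equal to 1 / (m + n), so the complement to 1 is the nonnegative n / (m
  -- + n).
  fraction∈[0,1] : ∀ m n {x} → 0# ≤ x → fromℕ (m ℕ.+ n) * x ≈ 1# → UnitInterval (fromℕ m * x)
  fraction∈[0,1] m n {x} 0≤x [m+n]x≈1 = *-nonNeg (fromℕ-nonNeg m) 0≤x , ≤-by (*-nonNeg (fromℕ-nonNeg n) 0≤x)
    (begin-equality
      1#                             ≈⟨ [m+n]x≈1 ⟨
      fromℕ (m ℕ.+ n) * x            ≈⟨ *-congʳ (fromℕ-+ m n) ⟩
      (fromℕ m + fromℕ n) * x        ≈⟨ distribʳ x _ _ ⟩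
      fromℕ m * x + fromℕ n * x      ∎)

  *-≤-1 : ∀ {x y} → UnitInterval x → UnitInterval y → x * y ≤ 1#
  *-≤-1 {x} {y} (0≤x , x≤1) (_ , y≤1) = ≤-by (+-nonNeg (*-nonNeg 0≤x (0≤y-x y≤1)) (0≤y-x x≤1))
    (solve 2 (λ x y → # 1 := x :* y :+ (x :* (# 1 :- y) :+ (# 1 :- x))) refl x y)

  -- Rounding `y` up to the grid costs at most `h`. The induction lowers `N` until the next grid
  -- point down falls below `y`. It is used to show that points which no grid cut separates are
  -- close.
  grid-≤ : ∀ {h x y} → 0# ≤ h → 0# ≤ y → ∀ N → y ≤ fromℕ N * h →
           (∀ j → j ℕ.≤ N → y ≤ fromℕ j * h → x ≤ fromℕ j * h) → x ≤ y + h
  grid-≤ {h} {x} {y} 0≤h 0≤y zero y≤0 cut = begin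
    x               ≤⟨ cut 0 ℕ.z≤n y≤0 ⟩
    fromℕ 0 * h     ≈⟨ trans (*-congʳ fromℕ-zero) (zeroˡ h) ⟩
    0#              ≤⟨ +-nonNeg 0≤y 0≤h ⟩
    y + h           ∎
  grid-≤ {h} {x} {y} 0≤h 0≤y (suc N) y≤Nh+h cut with ≤-total y (fromℕ N * h)
  ... | inj₁ y≤Nh = grid-≤ 0≤h 0≤y N y≤Nh (λ j j≤N → cut j (ℕ.m≤n⇒m≤1+n j≤N))
  ... | inj₂ Nh≤y = begin
    x                     ≤⟨ cut (suc N) ℕ.≤-refl y≤Nh+h ⟩
    fromℕ (suc N) * h     ≈⟨ *-congʳ (fromℕ-suc N) ⟩
    (1# + fromℕ N) * h    ≈⟨ solve 2 (λ n h → (# 1 :+ n) :* h := n :* h :+ h) refl (fromℕ N) h ⟩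
    fromℕ N * h + h       ≤⟨ +-monoˡ-≤ h Nh≤y ⟩
    y + h                 ∎

-- Pointwise bounds on the integrand of `Ψ`.

module Kernel (ℝ : CompleteOrderedField) where

  open CompleteOrderedField ℝ
  open OrderedField ℝ
  open ≤-Reasoning

  -- The integrand of `Ψ` at `y`, with `l` in place of λ and `i` in place of the indicator of γ ≤ y.
  kernel : (y i l s a : Carrier) → Carrier
  kernel y i l s a = l + (fromℕ 2 - fromℕ 2 * l * (y ⊓ a)) * i + fromℕ 2 * l * (s - y) ⁺

  affine : (c₀ c₁ c₂ l u : Carrier) → Carrier
  affine c₀ c₁ c₂ l u = c₀ + c₁ * l + c₂ * u

  -- The kernel after min {y, a} becomes y and (s - y)₊ becomes θ (s - y), rewritten with u = l a
  -- and l s = 3 u - 1.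
  lowerʸ : (y i θ l u : Carrier) → Carrier
  lowerʸ y i θ l u = affine (fromℕ 2 * (i - θ)) (1# - fromℕ 2 * (y * i + y * θ)) (fromℕ 6 * θ) l u

  -- The kernel with i = 1 after min {y, a} becomes a and the positive part becomes 0.
  lowerᵃ : (l u : Carrier) → Carrier
  lowerᵃ l u = affine (fromℕ 2) 1# (- fromℕ 2) l u

  0≤2 : 0# ≤ fromℕ 2
  0≤2 = fromℕ-nonNeg 2

  -- The constraints satisfied by a point of the support, with l = 1 / (3 a - s).
  record Admissible (l s a : Carrier) : Set where
    field
      0≤l     : 0# ≤ l
      0≤s     : 0# ≤ s
      s≤a     : s ≤ a
      a≤1     : a ≤ 1#
      inverse : (fromℕ 3 * a - s) * l ≈ 1#

    0≤a : 0# ≤ a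
    0≤a = ≤-trans 0≤s s≤a

    l*a≤l : l * a ≤ l
    l*a≤l = ≤-by (*-nonNeg 0≤l (0≤y-x a≤1))
      (solve 2 (λ l a → l := l :* a :+ l :* (# 1 :- a)) refl l a)

    -- By `inverse`, 1 is 2 l a plus the nonnegative l (a - s).
    2la≤1 : fromℕ 2 * l * a ≤ 1#
    2la≤1 = ≤-by (*-nonNeg 0≤l (0≤y-x s≤a)) (trans (sym inverse)
      (solve 3 (λ l s a → (# 3 :* a :- s) :* l := # 2 :* l :* a :+ l :* (a :- s)) refl l s a))

    -- Eliminates `s`, so that the minorants become affine in l and l a.
    l*s≈ : l * s ≈ fromℕ 3 * (l * a) - 1#
    l*s≈ = begin-equality
      l * s
        ≈⟨ solve 3 (λ l s a → l :* s := # 3 :* (l :* a) :- (# 3 :* a :- s) :* l) refl l s a ⟩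
      fromℕ 3 * (l * a) - (fromℕ 3 * a - s) * l     ≈⟨ +-congˡ (-‿cong inverse) ⟩
      fromℕ 3 * (l * a) - 1#                        ∎

    1≤3la : 1# ≤ fromℕ 3 * (l * a)
    1≤3la = ≤-by (*-nonNeg 0≤l 0≤s) (begin-equality
      fromℕ 3 * (l * a)                ≈⟨ solve 1 (λ x → x := # 1 :+ (x :- # 1)) refl _ ⟩
      1# + (fromℕ 3 * (l * a) - 1#)    ≈⟨ +-congˡ l*s≈ ⟨
      1# + l * s                       ∎)

    -- Chain 2 ≤ 6 l a ≤ l, the first step being `1≤3la`.
    2≤l : fromℕ 6 * a ≤ 1# → fromℕ 2 ≤ l
    2≤l 6a≤1 = ≤-by (+-nonNeg (*-nonNeg 0≤2 (0≤y-x 1≤3la)) (*-nonNeg 0≤l (0≤y-x 6a≤1)))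
      (solve 2 (λ l a → l := # 2 :+ (# 2 :* (# 3 :* (l :* a) :- # 1) :+ l :* (# 1 :- # 6 :* a))) refl l a)

    -- Chain l ≤ 6 l a ≤ 3. Away from a = 0 this makes l a Lipschitz function of s and a.
    l≤3 : 1# ≤ fromℕ 6 * a → l ≤ fromℕ 3
    l≤3 1≤6a = ≤-by (+-nonNeg (*-nonNeg (fromℕ-nonNeg 3) (0≤y-x 2la≤1)) (*-nonNeg 0≤l (0≤y-x 1≤6a)))
      (solve 2 (λ l a → # 3 := l :+ (# 3 :* (# 1 :- # 2 :* l :* a) :+ l :* (# 6 :* a :- # 1))) refl l a)

    0≤2l : 0# ≤ fromℕ 2 * l
    0≤2l = *-nonNeg 0≤2 0≤l

    -- The other two summands are nonnegative, because 2 l min {y, a} ≤ 2 l a ≤ 1. This yields both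
    -- the nonnegativity of the integrand and the bound on cells with small a.
    l≤kernel : ∀ y {i} → 0# ≤ i → l ≤ kernel y i l s a
    l≤kernel y 0≤i = ≤-by (+-nonNeg (*-nonNeg (0≤y-x 2lm≤2) 0≤i) (*-nonNeg 0≤2l (x≤y⊔x (s - y) 0#))) (+-assoc _ _ _)
      where
      2lm≤2 : fromℕ 2 * l * (y ⊓ a) ≤ fromℕ 2
      2lm≤2 = begin
        fromℕ 2 * l * (y ⊓ a)   ≤⟨ *-monoˡ-≤ 0≤2l (x⊓y≤y y a) ⟩
        fromℕ 2 * l * a         ≤⟨ 2la≤1 ⟩
        1#                      ≤⟨ ≤-by 0≤1 (solve 0 (# 2 := # 1 :+ # 1) refl) ⟩
        fromℕ 2                 ∎

    -- 9 = 1 + 6 + 2: the constant 2 is at most 6 l since 1 ≤ 3 l, and the positive part is at most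
    -- 1. Integrability thus passes from λ to the integrand.
    kernel≤9l : ∀ {y i} → 0# ≤ y → UnitInterval i → kernel y i l s a ≤ fromℕ 9 * l
    kernel≤9l {y} {i} 0≤y (0≤i , i≤1) =
      ≤-by (+-nonNeg (+-nonNeg (*-nonNeg 0≤2 (0≤y-x 1≤3l)) (*-nonNeg 0≤2l (0≤y-x z≤1)))
                     (+-nonNeg (*-nonNeg 0≤2 (0≤y-x i≤1)) (*-nonNeg (*-nonNeg 0≤2l (⊓-glb 0≤y 0≤a)) 0≤i)))
        (solve 4 (λ l m z i → # 9 :* l :=
            l :+ (# 2 :- # 2 :* l :* m) :* i :+ # 2 :* l :* z
            :+ (# 2 :* (# 3 :* l :- # 1) :+ # 2 :* l :* (# 1 :- z)
                :+ (# 2 :* (# 1 :- i) :+ # 2 :* l :* m :* i))) refl l (y ⊓ a) ((s - y) ⁺) i)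
      where
      1≤3l : 1# ≤ fromℕ 3 * l
      1≤3l = ≤-trans 1≤3la (*-monoˡ-≤ (fromℕ-nonNeg 3) l*a≤l)
      z≤1 : (s - y) ⁺ ≤ 1#
      z≤1 = ⊔-lub (≤-by (+-nonNeg (+-nonNeg (0≤y-x s≤a) (0≤y-x a≤1)) 0≤y)
        (solve 3 (λ s y a → # 1 := s :- y :+ (a :- s :+ (# 1 :- a) :+ y)) refl s y a)) 0≤1

    -- (s - y)⁺ is bounded below by θ (s - y), and y ⊓ a above by m.
    kernel-lower : ∀ {y m i θ} → y ⊓ a ≤ m → 0# ≤ i → UnitInterval θ →
                   l + (fromℕ 2 - fromℕ 2 * l * m) * i + fromℕ 2 * l * (θ * (s - y)) ≤ kernel y i l s a
    kernel-lower {y} {m} {i} {θ} ya≤m 0≤i (0≤θ , θ≤1) =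
      ≤-by (+-nonNeg (*-nonNeg (*-nonNeg 0≤2l (0≤y-x ya≤m)) 0≤i)
             (*-nonNeg 0≤2l (+-nonNeg (*-nonNeg 0≤θ (0≤y-x (x≤x⊔y (s - y) 0#))) (*-nonNeg (0≤y-x θ≤1) (x≤y⊔x (s - y) 0#)))))
        (solve 7 (λ l n m i z θ x →
            l :+ (# 2 :- # 2 :* l :* n) :* i :+ # 2 :* l :* z :=
            l :+ (# 2 :- # 2 :* l :* m) :* i :+ # 2 :* l :* (θ :* x)
            :+ (# 2 :* l :* (m :- n) :* i :+ # 2 :* l :* (θ :* (z :- x) :+ (# 1 :- θ) :* z)))
          refl l (y ⊓ a) m i ((s - y) ⁺) θ (s - y))

    kernel-lowerʸ : ∀ {y i θ} → 0# ≤ i → UnitInterval θ →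
                    lowerʸ y i θ l (l * a) ≤ kernel y i l s a
    kernel-lowerʸ {y} {i} {θ} 0≤i θ∈[0,1] = begin
      lowerʸ y i θ l (l * a)
        ≈⟨ solve 5 (λ l u y i θ →
             # 2 :* (i :- θ) :+ (# 1 :- # 2 :* (y :* i :+ y :* θ)) :* l :+ # 6 :* θ :* u :=
             l :+ (# 2 :- # 2 :* l :* y) :* i :+ # 2 :* (θ :* (# 3 :* u :- # 1 :- l :* y)))
             refl l (l * a) y i θ ⟩
      l + (fromℕ 2 - fromℕ 2 * l * y) * i + fromℕ 2 * (θ * (fromℕ 3 * (l * a) - 1# - l * y))
        ≈⟨ +-congˡ (*-congˡ (*-congˡ (+-congʳ l*s≈))) ⟨
      l + (fromℕ 2 - fromℕ 2 * l * y) * i + fromℕ 2 * (θ * (l * s - l * y))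
        ≈⟨ +-congˡ (solve 4 (λ l θ s y → # 2 :* (θ :* (l :* s :- l :* y)) := # 2 :* l :* (θ :* (s :- y))) refl l θ s y) ⟩
      l + (fromℕ 2 - fromℕ 2 * l * y) * i + fromℕ 2 * l * (θ * (s - y))
        ≤⟨ kernel-lower (x⊓y≤x y a) 0≤i θ∈[0,1] ⟩
      kernel y i l s a ∎

    kernel-lowerᵃ : ∀ {y} → lowerᵃ l (l * a) ≤ kernel y 1# l s a
    kernel-lowerᵃ {y} = begin
      lowerᵃ l (l * a)
        ≈⟨ solve 4 (λ l a s y → # 2 :+ # 1 :* l :+ (:- # 2) :* (l :* a) :=
             l :+ (# 2 :- # 2 :* l :* a) :* # 1 :+ # 2 :* l :* (# 0 :* (s :- y))) refl l a s y ⟩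
      l + (fromℕ 2 - fromℕ 2 * l * a) * 1# + fromℕ 2 * l * (0# * (s - y))
        ≤⟨ kernel-lower (x⊓y≤y y a) 0≤1 0∈[0,1] ⟩
      kernel y 1# l s a ∎

  -- Stability of the affine minorants under a change of point.

  Within : (e x y : Carrier) → Set
  Within e x y = x ≤ y + e × y ≤ x + e

  -- |c| ≤ 6 without absolute values; 6 dominates every slope of the minorants in use.
  AtMost6 : Carrier → Set
  AtMost6 c = 0# ≤ fromℕ 6 + c × 0# ≤ fromℕ 6 - c

  -- Weighting the two halves of `Within` by 6 - c and 6 + c gives twice the claim, which treats
  -- both signs of `c` at once.
  *-within : ∀ {c e x y} → AtMost6 c → Within e x y → c * x - fromℕ 6 * e ≤ c * y
  *-within {c} {e} {x} {y} (0≤6+c , 0≤6-c) (x≤y+e , y≤x+e) = fromℕ-cancelˡ-≤ 1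
    (≤-by (+-nonNeg (*-nonNeg 0≤6-c (0≤y-x y≤x+e)) (*-nonNeg 0≤6+c (0≤y-x x≤y+e)))
      (solve 4 (λ c e x y → # 2 :* (c :* y) := # 2 :* (c :* x :- # 6 :* e)
          :+ ((# 6 :- c) :* (x :+ e :- y) :+ (# 6 :+ c) :* (y :+ e :- x))) refl c e x y))

  affine-within : ∀ {c₀ c₁ c₂ e l l′ u u′} → AtMost6 c₁ → AtMost6 c₂ → Within e l l′ → Within e u u′ →
                  affine c₀ c₁ c₂ l u - fromℕ 12 * e ≤ affine c₀ c₁ c₂ l′ u′
  affine-within {c₀} {c₁} {c₂} {e} {l} {l′} {u} {u′} c₁≤6 c₂≤6 l~l′ u~u′ = begin
    c₀ + c₁ * l + c₂ * u - fromℕ 12 * e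
      ≈⟨ solve 4 (λ c x y e → c :+ x :+ y :- # 12 :* e := c :+ (x :- # 6 :* e) :+ (y :- # 6 :* e)) refl c₀ (c₁ * l) (c₂ * u) e ⟩
    c₀ + (c₁ * l - fromℕ 6 * e) + (c₂ * u - fromℕ 6 * e)
      ≤⟨ +-mono-≤ (+-mono-≤ ≤-refl (*-within c₁≤6 l~l′)) (*-within c₂≤6 u~u′) ⟩
    c₀ + c₁ * l′ + c₂ * u′ ∎

  module _ {l l′ s s′ a a′ h : Carrier} (A : Admissible l s a) (A′ : Admissible l′ s′ a′)
           (1≤6a : 1# ≤ fromℕ 6 * a) (1≤6a′ : 1# ≤ fromℕ 6 * a′) (0≤h : 0# ≤ h) where

    private
      module A  = Admissible A
      module A′ = Admissible A′

    -- l - l′ = l l′ ((3 a′ - s′) - (3 a - s)) and 0 ≤ l , l′ ≤ 3.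
    l-within : a′ ≤ a + h → s ≤ s′ + h → l ≤ l′ + fromℕ 36 * h
    l-within a′≤a+h s≤s′+h = ≤-by
      (+-nonNeg
        (*-nonNeg (*-nonNeg A.0≤l A′.0≤l) (+-nonNeg (*-nonNeg (fromℕ-nonNeg 3) (0≤y-x a′≤a+h)) (0≤y-x s≤s′+h)))
        (*-nonNeg (*-nonNeg (fromℕ-nonNeg 4) 0≤h)
          (+-nonNeg (*-nonNeg (fromℕ-nonNeg 3) (0≤y-x (A′.l≤3 1≤6a′))) (*-nonNeg A′.0≤l (0≤y-x (A.l≤3 1≤6a))))))
      (begin-equality
        l′ + fromℕ 36 * h
          ≈⟨ solve 3 (λ l l′ h → l′ :+ # 36 :* h := l :+ (l′ :* # 1 :- l :* # 1 :+ # 36 :* h)) refl l l′ h ⟩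
        l + (l′ * 1# - l * 1# + fromℕ 36 * h)
          ≈⟨ +-congˡ (+-congʳ (+-cong (*-congˡ A.inverse) (-‿cong (*-congˡ A′.inverse)))) ⟨
        l + (l′ * ((fromℕ 3 * a - s) * l) - l * ((fromℕ 3 * a′ - s′) * l′) + fromℕ 36 * h)
          ≈⟨ solve 7 (λ l l′ s s′ a a′ h →
               l :+ (l′ :* ((# 3 :* a :- s) :* l) :- l :* ((# 3 :* a′ :- s′) :* l′) :+ # 36 :* h) :=
               l :+ (l :* l′ :* (# 3 :* (a :+ h :- a′) :+ (s′ :+ h :- s))
                 :+ # 4 :* h :* (# 3 :* (# 3 :- l′) :+ l′ :* (# 3 :- l)))) refl l l′ s s′ a a′ h ⟩
        l + (l * l′ * (fromℕ 3 * (a + h - a′) + (s′ + h - s))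
          + fromℕ 4 * h * (fromℕ 3 * (fromℕ 3 - l′) + l′ * (fromℕ 3 - l))) ∎)

    -- Writes l a - l′ a′ as l (a - a′) + a′ (l - l′); with l ≤ 3 and a′ ≤ 1 the errors are 3 h and
    -- 36 h.
    la-within : a ≤ a′ + h → a′ ≤ a + h → s ≤ s′ + h → l * a ≤ l′ * a′ + fromℕ 39 * h
    la-within a≤a′+h a′≤a+h s≤s′+h = ≤-by
      (+-nonNeg (*-nonNeg A.0≤l (0≤y-x a≤a′+h))
        (+-nonNeg (*-nonNeg A′.0≤a (0≤y-x (l-within a′≤a+h s≤s′+h)))
          (+-nonNeg (*-nonNeg (0≤y-x (A.l≤3 1≤6a)) 0≤h) (*-nonNeg (*-nonNeg (fromℕ-nonNeg 36) 0≤h) (0≤y-x A′.a≤1)))))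
      (solve 5 (λ l l′ a a′ h → l′ :* a′ :+ # 39 :* h :=
          l :* a :+ (l :* (a′ :+ h :- a) :+ (a′ :* (l′ :+ # 36 :* h :- l)
            :+ ((# 3 :- l) :* h :+ # 36 :* h :* (# 1 :- a′))))) refl l l′ a a′ h)

  -- The first slope lies between -3 and 1, the second between 0 and 6.
  lowerʸ-slopes : ∀ {y i θ} → UnitInterval y → UnitInterval i → UnitInterval θ →
                  AtMost6 (1# - fromℕ 2 * (y * i + y * θ)) × AtMost6 (fromℕ 6 * θ)
  lowerʸ-slopes {y} {i} {θ} y∈@(0≤y , _) i∈@(0≤i , _) θ∈@(0≤θ , θ≤1) =
    ( ≤-respʳ-≈ (solve 2 (λ m n → # 3 :+ (# 2 :* (# 1 :- m) :+ # 2 :* (# 1 :- n)) :=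
                    # 6 :+ (# 1 :- # 2 :* (m :+ n))) refl (y * i) (y * θ))
        (+-nonNeg (fromℕ-nonNeg 3)
          (+-nonNeg (*-nonNeg 0≤2 (0≤y-x (*-≤-1 y∈ i∈))) (*-nonNeg 0≤2 (0≤y-x (*-≤-1 y∈ θ∈)))))
    , ≤-respʳ-≈ (solve 2 (λ m n → # 5 :+ # 2 :* (m :+ n) := # 6 :- (# 1 :- # 2 :* (m :+ n))) refl (y * i) (y * θ))
        (+-nonNeg (fromℕ-nonNeg 5) (*-nonNeg 0≤2 (+-nonNeg (*-nonNeg 0≤y 0≤i) (*-nonNeg 0≤y 0≤θ)))) )
    , ( +-nonNeg (fromℕ-nonNeg 6) (*-nonNeg (fromℕ-nonNeg 6) 0≤θ)
      , ≤-respʳ-≈ (solve 1 (λ θ → # 6 :* (# 1 :- θ) := # 6 :- # 6 :* θ) refl θ)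
          (*-nonNeg (fromℕ-nonNeg 6) (0≤y-x θ≤1)) )

  lowerᵃ-slopes : AtMost6 1# × AtMost6 (- fromℕ 2)
  lowerᵃ-slopes =
    ( +-nonNeg (fromℕ-nonNeg 6) 0≤1
    , ≤-respʳ-≈ (solve 0 (# 5 := # 6 :- # 1) refl) (fromℕ-nonNeg 5) )
    , ( ≤-respʳ-≈ (solve 0 (# 4 := # 6 :+ (:- # 2)) refl) (fromℕ-nonNeg 4)
      , ≤-respʳ-≈ (solve 0 (# 8 := # 6 :- (:- # 2)) refl) (fromℕ-nonNeg 8) )

  -- The weighted combination of the constraints and its certificates.

  weighted : (τ v₁ v₂ v₃ i₁ i₂ : Carrier) → Carrier
  weighted τ v₁ v₂ v₃ i₁ i₂ = fromℕ 966 * v₁ + fromℕ 1449 * v₂ + fromℕ 2898 * v₃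
              + fromℕ 1920 * (1# - fromℕ 7 * τ * i₁) + fromℕ 1960 * (1# - fromℕ 9 * τ * i₂)

  -- 5313 = 966 + 1449 + 2898 is the total weight of the constraints on `Ψ`.
  weighted-shift : ∀ {τ v₁ v₂ v₃ i₁ i₂} d →
                   weighted τ (v₁ - d) (v₂ - d) (v₃ - d) i₁ i₂ ≈ weighted τ v₁ v₂ v₃ i₁ i₂ - fromℕ 5313 * d
  weighted-shift {τ} {v₁} {v₂} {v₃} {i₁} {i₂} d =
    solve 6 (λ v₁ v₂ v₃ w₁ w₂ d →
      # 966 :* (v₁ :- d) :+ # 1449 :* (v₂ :- d) :+ # 2898 :* (v₃ :- d) :+ w₁ :+ w₂ :=
      # 966 :* v₁ :+ # 1449 :* v₂ :+ # 2898 :* v₃ :+ w₁ :+ w₂ :- # 5313 :* d)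
      refl v₁ v₂ v₃ (fromℕ 1920 * (1# - fromℕ 7 * τ * i₁)) (fromℕ 1960 * (1# - fromℕ 9 * τ * i₂)) d

  module _ {τ ρ : Carrier} (10τ≈1 : fromℕ 10 * τ ≈ 1#) (46ρ≈1 : fromℕ 46 * ρ ≈ 1#) where

    -- `τ` and `ρ` stand for 1/10 and 1/46 but are free variables to the solver, so identities hold
    -- only modulo 10 τ - 1 and 46 ρ - 1; `m` and `n` are the explicit cofactors.
    ≤-by-mod : ∀ {x y d m n} → 0# ≤ d → y ≈ x + d + m * (1# - fromℕ 10 * τ) + n * (1# - fromℕ 46 * ρ) → x ≤ y
    ≤-by-mod {x} {y} {d} {m} {n} 0≤d eq = ≤-by 0≤d (begin-equality
      y                                                                   ≈⟨ eq ⟩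
      x + d + m * (1# - fromℕ 10 * τ) + n * (1# - fromℕ 46 * ρ)
        ≈⟨ +-cong (+-congˡ (*-congˡ (+-congˡ (-‿cong 10τ≈1)))) (*-congˡ (+-congˡ (-‿cong 46ρ≈1))) ⟩
      x + d + m * (1# - 1#) + n * (1# - 1#)
        ≈⟨ solve 3 (λ z m n → z :+ m :* (# 1 :- # 1) :+ n :* (# 1 :- # 1) := z) refl (x + d) m n ⟩
      x + d                                                               ∎)

    private
      -- Solver syntax for `lowerʸ`, and then for `weighted` with `lowerᵃ` already substituted as
      -- the third value.
      :lowerʸ : ∀ {n} (y i θ l u : Polynomial n) → Polynomial n
      :lowerʸ y i θ l u =
        # 2 :* (i :- θ) :+ (# 1 :- # 2 :* (y :* i :+ y :* θ)) :* l :+ # 6 :* θ :* u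

      :weighted : ∀ {n} (τ v₁ v₂ l u i₁ i₂ : Polynomial n) → Polynomial n
      :weighted τ v₁ v₂ l u i₁ i₂ =
        # 966 :* v₁ :+ # 1449 :* v₂
        :+ # 2898 :* (# 2 :+ # 1 :* l :+ (:- # 2) :* u)
        :+ # 1920 :* (# 1 :- # 7 :* τ :* i₁)
        :+ # 1960 :* (# 1 :- # 9 :* τ :* i₂)

    -- The case γ ≤ 7/10. The weights are balanced so that l and u cancel and equality holds: 2898 +
    -- 5796 from `Ψ`, and 576 + 196 from `F`.
    certificate₁ : ∀ l u → fromℕ 9466 ≤
      weighted τ (lowerʸ (fromℕ 7 * τ) 1# 1# l u) (lowerʸ (fromℕ 9 * τ) 1# 0# l u) (lowerᵃ l u) 1# 1#
    certificate₁ l u = ≤-by-mod ≤-refl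
      (solve 4 (λ l u τ ρ →
        :weighted τ (:lowerʸ (# 7 :* τ) (# 1) (# 1) l u)
                    (:lowerʸ (# 9 :* τ) (# 1) (# 0) l u) l u (# 1) (# 1)
        := # 9466 :+ # 0
           :+ (# 5313 :* l :+ # 3108) :* (# 1 :- # 10 :* τ)
           :+ # 0 :* (# 1 :- # 46 :* ρ))
        refl l u τ ρ)

    -- Here and in certificate₃, θ is chosen to make the bound an equality at s = 7/10, a = 1.
    certificate₂ : ∀ {l u} → u ≤ l → fromℕ 9466 ≤
      weighted τ (lowerʸ (fromℕ 7 * τ) 0# (fromℕ 32 * ρ) l u) (lowerʸ (fromℕ 9 * τ) 1# 0# l u) (lowerᵃ l u) 0# 1#
    certificate₂ {l} {u} u≤l = ≤-by-mod (*-nonNeg (fromℕ-nonNeg 1764) (0≤y-x u≤l))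
      (solve 4 (λ l u τ ρ →
        :weighted τ (:lowerʸ (# 7 :* τ) (# 0) (# 32 :* ρ) l u)
                    (:lowerʸ (# 9 :* τ) (# 1) (# 0) l u) l u (# 0) (# 1)
        := # 9466 :+ # 1764 :* (l :- u)
           :+ (# 3549 :* l :+ # 1764) :* (# 1 :- # 10 :* τ)
           :+ (# 9408 :* τ :* l :- # 4032 :* u :+ # 1344) :* (# 1 :- # 46 :* ρ))
        refl l u τ ρ)

    certificate₃ : ∀ {l u} → u ≤ l → fromℕ 9466 ≤
      weighted τ (lowerʸ (fromℕ 7 * τ) 0# (fromℕ 5 * ρ) l u) (lowerʸ (fromℕ 9 * τ) 0# 0# l u) (lowerᵃ l u) 0# 0#
    certificate₃ {l} {u} u≤l = ≤-by-mod (*-nonNeg (fromℕ-nonNeg 5166) (0≤y-x u≤l))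
      (solve 4 (λ l u τ ρ →
        :weighted τ (:lowerʸ (# 7 :* τ) (# 0) (# 5 :* ρ) l u)
                    (:lowerʸ (# 9 :* τ) (# 0) (# 0) l u) l u (# 0) (# 0)
        := # 9466 :+ # 5166 :* (l :- u)
           :+ (# 147 :* l) :* (# 1 :- # 10 :* τ)
           :+ (# 1470 :* τ :* l :- # 630 :* u :+ # 210) :* (# 1 :- # 46 :* ρ))
        refl l u τ ρ)

    -- The worst case has both indicators equal to 1, and even then 1932 is left over.
    certificate₀ : ∀ {i₁ i₂} → UnitInterval i₁ → UnitInterval i₂ → fromℕ 9466 ≤
      weighted τ (fromℕ 2) (fromℕ 2) (fromℕ 2) i₁ i₂
    certificate₀ {i₁} {i₂} (_ , i₁≤1) (_ , i₂≤1) = ≤-by-mod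
      (+-nonNeg (*-nonNeg (*-nonNeg (fromℕ-nonNeg 13440) (reciprocal-nonNeg 9 10τ≈1)) (0≤y-x i₁≤1))
        (+-nonNeg (*-nonNeg (*-nonNeg (fromℕ-nonNeg 17640) (reciprocal-nonNeg 9 10τ≈1)) (0≤y-x i₂≤1)) (fromℕ-nonNeg 1932)))
      (solve 4 (λ τ ρ i₁ i₂ →
        # 966 :* # 2 :+ # 1449 :* # 2 :+ # 2898 :* # 2
        :+ # 1920 :* (# 1 :- # 7 :* τ :* i₁)
        :+ # 1960 :* (# 1 :- # 9 :* τ :* i₂)
        := # 9466
           :+ (# 13440 :* τ :* (# 1 :- i₁) :+ (# 17640 :* τ :* (# 1 :- i₂) :+ # 1932))
           :+ # 3108 :* (# 1 :- # 10 :* τ)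
           :+ # 0 :* (# 1 :- # 46 :* ρ))
        refl τ ρ i₁ i₂)

-- Finite sums.

module Sums (ℝ : CompleteOrderedField) where

  open CompleteOrderedField ℝ
  open OrderedField ℝ
  open CommutativeMonoidSum +-commutativeMonoid public
    using (∑-distrib-+) renaming (sum-cong-≋ to ∑-cong; sum-replicate-zero to ∑-zero)
  open SemiringSum semiring public using () renaming (*-distribˡ-sum to *-distribˡ-∑)
  open ≤-Reasoning

  ∑-mono-≤ : ∀ {n} {f g : Fin n → Carrier} → (∀ i → f i ≤ g i) → ∑ f ≤ ∑ g
  ∑-mono-≤ {zero}  f≤g = ≤-refl
  ∑-mono-≤ {suc n} f≤g = +-mono-≤ (f≤g zero) (∑-mono-≤ (f≤g ∘ suc))

  ∑-≈0 : ∀ {n} {f : Fin n → Carrier} → (∀ i → f i ≈ 0#) → ∑ f ≈ 0#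
  ∑-≈0 {n} f≈0 = trans (∑-cong f≈0) (∑-zero n)

  ∑-splitAt : ∀ m {n} (f : Fin m ⊎ Fin n → Carrier) →
              ∑ (f ∘ splitAt m) ≈ ∑ (f ∘ inj₁) + ∑ (f ∘ inj₂)
  ∑-splitAt zero    f = sym (+-identityˡ _)
  ∑-splitAt (suc m) f = begin-equality
    f (inj₁ zero) + ∑ (f ∘ Sum.map₁ suc ∘ splitAt m)
      ≈⟨ +-congˡ (∑-splitAt m (f ∘ Sum.map₁ suc)) ⟩
    f (inj₁ zero) + (∑ (f ∘ inj₁ ∘ suc) + ∑ (f ∘ inj₂))               ≈⟨ +-assoc _ _ _ ⟨
    f (inj₁ zero) + ∑ (f ∘ inj₁ ∘ suc) + ∑ (f ∘ inj₂)                 ∎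

-- Suprema, indicators and finite Borel partitions.

module Integration (em : ExcludedMiddle 0ℓ) (ℝ : CompleteOrderedField) where

  open CompleteOrderedField ℝ
  open OrderedField ℝ
  open Sums ℝ
  open Probability em ℝ
  open ≤-Reasoning

  sup-upper : ∀ {P} → BoundedAbove P → UpperBound P (sup P)
  sup-upper {P} bdd r r∈P with em {Satisfiable P × BoundedAbove P}
  ... | yes (ne , bdd′) = proj₁ (proj₂ (complete P ne bdd′)) r r∈P
  ... | no ¬ne×bdd      = contradiction ((r , r∈P) , bdd) ¬ne×bdd

  -- Covers an empty `P` as well, because `sup` then takes its default value `0#`.
  sup-≤0 : ∀ {P} → UpperBound P 0# → sup P ≤ 0#
  sup-≤0 {P} P≤0 with em {Satisfiable P × BoundedAbove P}
  ... | yes (ne , bdd) = proj₂ (proj₂ (complete P ne bdd)) 0# P≤0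
  ... | no _           = ≤-refl

  𝟏-true : ∀ {A} → A → 𝟏[ A ] ≈ 1#
  𝟏-true {A} a with em {A}
  ... | yes _ = refl
  ... | no ¬a = contradiction a ¬a

  𝟏-false : ∀ {A} → ¬ A → 𝟏[ A ] ≈ 0#
  𝟏-false {A} ¬a with em {A}
  ... | yes a = contradiction a ¬a
  ... | no _  = refl

  -- Presents finitely many codes as the infinite sequence that `union` expects, by repeating the
  -- last one.
  sequence : Borel → Borel → Borel → ℕ → Borel
  sequence A B C 0             = A
  sequence A B C 1             = B
  sequence A B C (suc (suc _)) = C

  infixr 7 _∩_
  -- De Morgan, as codes offer only complements and countable unions; membership in a factor is
  -- therefore recovered by excluded middle.
  _∩_ : Borel → Borel → Borel
  A ∩ B = compl (union (sequence (compl A) (compl B) (compl B)))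

  module _ {A B : Borel} {p : Point} where

    ∩-intro : p ∈ ⟦ A ⟧ → p ∈ ⟦ B ⟧ → p ∈ ⟦ A ∩ B ⟧
    ∩-intro p∈A p∈B (0 , p∉A)           = p∉A p∈A
    ∩-intro p∈A p∈B (1 , p∉B)           = p∉B p∈B
    ∩-intro p∈A p∈B (suc (suc _) , p∉B) = p∉B p∈B

    ∩-elimˡ : p ∈ ⟦ A ∩ B ⟧ → p ∈ ⟦ A ⟧
    ∩-elimˡ p∈A∩B = decidable-stable em λ p∉A → p∈A∩B (0 , p∉A)

    ∩-elimʳ : p ∈ ⟦ A ∩ B ⟧ → p ∈ ⟦ B ⟧
    ∩-elimʳ p∈A∩B = decidable-stable em λ p∉B → p∈A∩B (1 , p∉B)

  -- `compl ∅` serves as the whole space, and `∅-empty` is at the same time the proof that every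
  -- point lies in it.
  ∅ : Borel
  ∅ = [γ≤ 0# ] ∩ compl [γ≤ 0# ]

  ∅-empty : Empty ⟦ ∅ ⟧
  ∅-empty p p∈∅ = ∩-elimʳ {[γ≤ 0# ]} p∈∅ (∩-elimˡ {[γ≤ 0# ]} {compl [γ≤ 0# ]} p∈∅)

  record Partition : Set where
    field
      size   : ℕ
      cell   : Fin size → Borel
      unique : ∀ i j {p} → p ∈ ⟦ cell i ⟧ → p ∈ ⟦ cell j ⟧ → i ≡ j
      cover  : ∀ p → ∃ λ i → p ∈ ⟦ cell i ⟧

  module Split (π : Partition) (B : Borel) where

    open Partition π

    -- Indexing by a disjoint sum allows case analysis by constructor; `splitAt` carries the family
    -- over to `Fin`.
    halves : Fin size ⊎ Fin size → Borel
    halves = [ (λ i → cell i ∩ B) , (λ i → cell i ∩ compl B) ]′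

    halves-unique : ∀ x y {p} → p ∈ ⟦ halves x ⟧ → p ∈ ⟦ halves y ⟧ → x ≡ y
    halves-unique (inj₁ i) (inj₁ j) p∈i p∈j = ≡.cong inj₁ (unique i j (∩-elimˡ {cell i} {B} p∈i) (∩-elimˡ {cell j} {B} p∈j))
    halves-unique (inj₁ i) (inj₂ j) p∈i p∈j = contradiction (∩-elimʳ {cell i} {B} p∈i) (∩-elimʳ {cell j} {compl B} p∈j)
    halves-unique (inj₂ i) (inj₁ j) p∈i p∈j = contradiction (∩-elimʳ {cell j} {B} p∈j) (∩-elimʳ {cell i} {compl B} p∈i)
    halves-unique (inj₂ i) (inj₂ j) p∈i p∈j = ≡.cong inj₂ (unique i j
      (∩-elimˡ {cell i} {compl B} p∈i) (∩-elimˡ {cell j} {compl B} p∈j))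

    halves-cover : ∀ p → ∃ λ x → p ∈ ⟦ halves x ⟧
    halves-cover p with cover p | em {p ∈ ⟦ B ⟧}
    ... | i , p∈i | yes p∈B = inj₁ i , ∩-intro {cell i} {B} p∈i p∈B
    ... | i , p∈i | no p∉B  = inj₂ i , ∩-intro {cell i} {compl B} p∈i p∉B

    split : Partition
    split = record
      { size   = size ℕ.+ size
      ; cell   = halves ∘ splitAt size
      ; unique = λ i j p∈i p∈j → splitAt-injective i j (halves-unique (splitAt size i) (splitAt size j) p∈i p∈j)
      ; cover  = λ p → let x , p∈x = halves-cover p in
          join size size x , ≡.subst (λ y → p ∈ ⟦ halves y ⟧) (≡.sym (splitAt-join size size x)) p∈x
      }
      where
      splitAt-injective : ∀ i j → splitAt size i ≡ splitAt size j → i ≡ j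
      splitAt-injective i j eq = ≡.trans (≡.sym (join-splitAt size size i)) (≡.trans
          (≡.cong (join size size) eq) (join-splitAt size size j))

  Decides : Partition → Borel → Set
  Decides π B = ∀ i → ⟦ cell i ⟧ ⊆ ⟦ B ⟧ ⊎ ⟦ cell i ⟧ ⊆ ⟦ compl B ⟧
    where open Partition π

  refine : List Borel → Partition
  refine []       = record
    { size   = 1
    ; cell   = λ _ → compl ∅
    ; unique = λ { zero zero _ _ → ≡.refl }
    ; cover  = λ p → zero , ∅-empty p
    }
  refine (B ∷ Bs) = Split.split (refine Bs) B

  -- The newest set is decided by the choice of half; earlier sets are decided by the coarser cell
  -- that contains the half.
  refine-decides : ∀ Bs {B} → B ∈ˡ Bs → Decides (refine Bs) B
  refine-decides (B ∷ Bs) B∈ i = decides B∈ (splitAt size i)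
    where
    open Partition (refine Bs)
    open Split (refine Bs) B
    decides : ∀ {C} → C ∈ˡ B ∷ Bs → ∀ x → ⟦ halves x ⟧ ⊆ ⟦ C ⟧ ⊎ ⟦ halves x ⟧ ⊆ ⟦ compl C ⟧
    decides (here ≡.refl) (inj₁ j) = inj₁ (∩-elimʳ {cell j} {B})
    decides (here ≡.refl) (inj₂ j) = inj₂ (∩-elimʳ {cell j} {compl B})
    decides (there C∈)    (inj₁ j) = [ (λ j⊆C → inj₁ (λ {p} p∈ → j⊆C (∩-elimˡ {cell j} {B} p∈)))
                                     , (λ j⊆C → inj₂ (λ {p} p∈ → j⊆C (∩-elimˡ {cell j} {B} p∈))) ]′
                                     (refine-decides Bs C∈ j)
    decides (there C∈)    (inj₂ j) = [ (λ j⊆C → inj₁ (λ {p} p∈ → j⊆C (∩-elimˡ {cell j} {compl B} p∈)))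
                                     , (λ j⊆C → inj₂ (λ {p} p∈ → j⊆C (∩-elimˡ {cell j} {compl B} p∈))) ]′
                                     (refine-decides Bs C∈ j)

  -- Finite additivity, deduced from countable additivity.

  module Measure (η : ProbabilityMeasure) where

    open ProbabilityMeasure η

    -- The constant sequence `B` is pairwise disjoint with union `B`, and its two-term partial sum
    -- gives 2 ℙ B ≤ ℙ B.
    ℙ-empty : ∀ B → Empty ⟦ B ⟧ → ℙ B ≈ 0#
    ℙ-empty B B-empty = antisym ℙB≤0 (ℙ-nonNeg B)
      where
      2ℙB≤ℙB : ℙ B + (ℙ B + 0#) ≤ ℙ B
      2ℙB≤ℙB = begin
        ℙ B + (ℙ B + 0#)
          ≤⟨ proj₁ (ℙ-union (λ _ → B) (λ _ _ _ → λ {(p∈B , _) → B-empty _ p∈B})) _ (2 , refl) ⟩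
        ℙ (union (λ _ → B))   ≈⟨ ℙ-cong _ _ ((λ (_ , p∈B) → p∈B) , (λ p∈B → 0 , p∈B)) ⟩
        ℙ B                   ∎
      ℙB≤0 : ℙ B ≤ 0#
      ℙB≤0 = ≤-by (0≤y-x 2ℙB≤ℙB) (solve 1 (λ x → # 0 := x :+ (x :- (x :+ (x :+ # 0)))) refl (ℙ B))

    -- The two pieces padded by `∅` form a disjoint sequence whose partial sums reach their supremum
    -- after two terms.
    ℙ-split : ∀ A B → ℙ A ≈ ℙ (A ∩ B) + ℙ (A ∩ compl B)
    ℙ-split A B = begin-equality
      ℙ A                              ≈⟨ ℙ-cong _ _ ((λ {p} → A⊆pieces {p}) , λ {p} → pieces⊆A {p}) ⟩
      ℙ (union pieces)
        ≈⟨ antisym (proj₂ supremum _ bound) (≤-respˡ-≈ (+-congˡ (+-identityʳ _)) (proj₁ supremum _ (2 , refl))) ⟩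
      ℙ (A ∩ B) + ℙ (A ∩ compl B)      ∎
      where
      pieces : ℕ → Borel
      pieces = sequence (A ∩ B) (A ∩ compl B) ∅
      A⊆pieces : ⟦ A ⟧ ⊆ ⟦ union pieces ⟧
      A⊆pieces {p} p∈A with em {p ∈ ⟦ B ⟧}
      ... | yes p∈B = 0 , ∩-intro {A} {B} p∈A p∈B
      ... | no p∉B  = 1 , ∩-intro {A} {compl B} p∈A p∉B
      pieces⊆A : ⟦ union pieces ⟧ ⊆ ⟦ A ⟧
      pieces⊆A (0 , p∈)               = ∩-elimˡ {A} {B} p∈
      pieces⊆A (1 , p∈)               = ∩-elimˡ {A} {compl B} p∈
      pieces⊆A {p} (suc (suc _) , p∈) = contradiction p∈ (∅-empty p)
      disjoint : ∀ m n → ¬ m ≡ n → ⟦ pieces m ⟧ ⊥ ⟦ pieces n ⟧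
      disjoint 0             0             0≢0 _           = 0≢0 ≡.refl
      disjoint 0             1             _   (p∈ , q∈)   = ∩-elimʳ {A} {compl B} q∈ (∩-elimʳ {A} {B} p∈)
      disjoint 1             0             _   (p∈ , q∈)   = ∩-elimʳ {A} {compl B} p∈ (∩-elimʳ {A} {B} q∈)
      disjoint 1             1             1≢1 _           = 1≢1 ≡.refl
      disjoint (suc (suc _)) _             _   (p∈ , _)    = ∅-empty _ p∈
      disjoint 0             (suc (suc _)) _   (_ , p∈)    = ∅-empty _ p∈
      disjoint 1             (suc (suc _)) _   (_ , p∈)    = ∅-empty _ p∈
      supremum = ℙ-union pieces disjoint
      bound : UpperBound _ (ℙ (A ∩ B) + ℙ (A ∩ compl B))
      bound r (0 , r≈) = ≤-respˡ-≈ (sym r≈) (+-nonNeg (ℙ-nonNeg _) (ℙ-nonNeg _))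
      bound r (1 , r≈) = ≤-respˡ-≈ (sym r≈) (+-mono-≤ ≤-refl (ℙ-nonNeg _))
      -- All later terms are probabilities of `∅`, so the partial sums stay constant from here on.
      bound r (suc (suc n) , r≈) = ≤-reflexive (trans r≈
        (+-congˡ (trans (+-congˡ (∑-≈0 {n} λ _ → ℙ-empty ∅ ∅-empty)) (+-identityʳ _))))

    ℙ-mono : ∀ A B → ⟦ A ⟧ ⊆ ⟦ B ⟧ → ℙ A ≤ ℙ B
    ℙ-mono A B A⊆B = ≤-by (ℙ-nonNeg (B ∩ compl A)) (trans (ℙ-split B A)
      (+-congʳ (ℙ-cong _ _ ((λ p∈ → ∩-elimʳ {B} {A} p∈) , λ p∈A → ∩-intro {B} {A} (A⊆B p∈A) p∈A))))

    -- Induction on the number of cells: removing the first cell from `B` leaves a set covered by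
    -- the others, on which their traces are unchanged.
    ℙ-∑ : ∀ {n} (c : Fin n → Borel) → (∀ i j {p} → p ∈ ⟦ c i ⟧ → p ∈ ⟦ c j ⟧ → i ≡ j) →
          ∀ B → (∀ {p} → p ∈ ⟦ B ⟧ → ∃ λ i → p ∈ ⟦ c i ⟧) → ∑ (λ i → ℙ (c i ∩ B)) ≈ ℙ B
    ℙ-∑ {zero}  c unique B cover = sym (ℙ-empty B λ p p∈B → Fin0-empty (proj₁ (cover p∈B)))
      where
      Fin0-empty : ¬ Fin 0
      Fin0-empty ()
    ℙ-∑ {suc n} c unique B cover = begin-equality
      ℙ (c₀ ∩ B) + ∑ (λ i → ℙ (c (suc i) ∩ B))
        ≈⟨ +-cong (ℙ-cong _ _ (∩-swap , ∩-swap′)) (∑-cong λ i → ℙ-cong _ _ (avoid i , avoid′ i)) ⟩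
      ℙ (B ∩ c₀) + ∑ (λ i → ℙ (c (suc i) ∩ B′))         ≈⟨ +-congˡ (ℙ-∑ (c ∘ suc) unique′ B′ cover′) ⟩
      ℙ (B ∩ c₀) + ℙ (B ∩ compl c₀)                     ≈⟨ ℙ-split B c₀ ⟨
      ℙ B                                               ∎
      where
      c₀ = c zero
      B′ = B ∩ compl c₀
      ∩-swap : ⟦ c₀ ∩ B ⟧ ⊆ ⟦ B ∩ c₀ ⟧
      ∩-swap p∈ = ∩-intro {B} {c₀} (∩-elimʳ {c₀} {B} p∈) (∩-elimˡ {c₀} {B} p∈)
      ∩-swap′ : ⟦ B ∩ c₀ ⟧ ⊆ ⟦ c₀ ∩ B ⟧
      ∩-swap′ p∈ = ∩-intro {c₀} {B} (∩-elimʳ {B} {c₀} p∈) (∩-elimˡ {B} {c₀} p∈)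
      avoid : ∀ i → ⟦ c (suc i) ∩ B ⟧ ⊆ ⟦ c (suc i) ∩ B′ ⟧
      avoid i p∈ = ∩-intro {c (suc i)} {B′} p∈i
        (∩-intro {B} {compl c₀} (∩-elimʳ {c (suc i)} {B} p∈) λ p∈₀ → 0≢1+n (unique zero (suc i) p∈₀ p∈i))
        where
        p∈i = ∩-elimˡ {c (suc i)} {B} p∈
      avoid′ : ∀ i → ⟦ c (suc i) ∩ B′ ⟧ ⊆ ⟦ c (suc i) ∩ B ⟧
      avoid′ i p∈ = ∩-intro {c (suc i)} {B} (∩-elimˡ {c (suc i)} {B′} p∈)
        (∩-elimˡ {B} {compl c₀} (∩-elimʳ {c (suc i)} {B′} p∈))
      unique′ : ∀ i j {p} → p ∈ ⟦ c (suc i) ⟧ → p ∈ ⟦ c (suc j) ⟧ → i ≡ j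
      unique′ i j p∈i p∈j = suc-injective (unique (suc i) (suc j) p∈i p∈j)
      cover′ : ∀ {p} → p ∈ ⟦ B′ ⟧ → ∃ λ i → p ∈ ⟦ c (suc i) ⟧
      cover′ p∈ with cover (∩-elimˡ {B} {compl c₀} p∈)
      ... | zero  , p∈₀ = contradiction p∈₀ (∩-elimʳ {B} {compl c₀} p∈)
      ... | suc i , p∈i = i , p∈i

    module _ (π : Partition) where

      open Partition π

      ∑-ℙ-cell-∩ : ∀ B → ∑ (λ i → ℙ (cell i ∩ B)) ≈ ℙ B
      ∑-ℙ-cell-∩ B = ℙ-∑ cell unique B (λ {p} _ → cover p)

      ∑-ℙ-cell : ∑ (ℙ ∘ cell) ≈ 1#
      ∑-ℙ-cell = begin-equality
        ∑ (ℙ ∘ cell)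
          ≈⟨ ∑-cong (λ i → ℙ-cong _ _ ((λ p∈ → ∩-intro {cell i} {compl ∅} p∈ (∅-empty _)) , ∩-elimˡ {cell i} {compl ∅})) ⟩
        ∑ (λ i → ℙ (cell i ∩ compl ∅)) ≈⟨ ∑-ℙ-cell-∩ (compl ∅) ⟩
        ℙ (compl ∅)                    ≈⟨ ℙ-total _ ∅-empty ⟩
        1#                             ∎

    simpleBelow : ∀ {f} (π : Partition) (v : Fin (Partition.size π) → Carrier) →
                  (∀ i p → p ∈ ⟦ Partition.cell π i ⟧ → v i ≤ f p) → SimpleBelow f
    simpleBelow π v v≤f = record
      { size     = size
      ; cell     = cell
      ; disjoint = λ i j i≢j (p∈i , p∈j) → i≢j (unique i j p∈i p∈j)
      ; cover    = cover
      ; value    = v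
      ; below    = v≤f
      }
      where open Partition π

    partition : ∀ {f} → SimpleBelow f → Partition
    partition φ = record
      { size   = size
      ; cell   = cell
      ; unique = λ i j p∈i p∈j → decidable-stable em λ i≢j → disjoint i j i≢j (p∈i , p∈j)
      ; cover  = cover
      }
      where open SimpleBelow φ

    -- Integrals of functions controlled on the support.

    module _ {S : Pred Point 0ℓ} (supported : SupportedOn η S) where

      private
        A   = proj₁ supported
        A⊆S = proj₁ (proj₁ (proj₂ supported))
        S⊆A = proj₂ (proj₁ (proj₂ supported))
        ℙA≈1 = proj₂ (proj₂ supported)

      -- The code for `S` already carries mass 1, and `B` is disjoint from it.
      ℙ-null : ∀ B → (∀ p → p ∈ ⟦ B ⟧ → p ∉ S) → ℙ B ≈ 0#
      ℙ-null B B∩S=∅ = antisym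
        (≤-by (0≤y-x ℙA+ℙB≤ℙA) (solve 2 (λ a b → # 0 := b :+ (a :- (b :+ a))) refl (ℙ A) (ℙ B)))
        (ℙ-nonNeg B)
        where
        ℙA+ℙB≤ℙA : ℙ B + ℙ A ≤ ℙ A
        ℙA+ℙB≤ℙA = begin
          ℙ B + ℙ A                                  ≈⟨ +-comm _ _ ⟩
          ℙ A + ℙ B
            ≤⟨ +-mono-≤ (ℙ-mono A (compl ∅ ∩ A) λ p∈A → ∩-intro {compl ∅} {A} (∅-empty _) p∈A)
             (ℙ-mono B (compl ∅ ∩ compl A) λ p∈B →
               ∩-intro {compl ∅} {compl A} (∅-empty _) λ p∈A → B∩S=∅ _ p∈B (A⊆S p∈A)) ⟩
          ℙ (compl ∅ ∩ A) + ℙ (compl ∅ ∩ compl A)    ≈⟨ ℙ-split (compl ∅) A ⟨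
          ℙ (compl ∅)                                ≈⟨ ℙ-total _ ∅-empty ⟩
          1#                                         ≈⟨ ℙA≈1 ⟨
          ℙ A                                        ∎

      -- A cell that meets `S` has a nonpositive value, and a cell that misses `S` has measure zero.
      lowerSum-nonPos : ∀ {f} → (∀ p → p ∈ S → f p ≤ 0#) → (φ : SimpleBelow f) → lowerSum η φ ≤ 0#
      lowerSum-nonPos {f} f≤0 φ = ≤-respʳ-≈ (∑-zero size) (∑-mono-≤ term)
        where
        open SimpleBelow φ
        term : ∀ i → value i * ℙ (cell i) ≤ 0#
        term i with em {∃ λ p → p ∈ ⟦ cell i ⟧ × p ∈ S}
        ... | yes (p , p∈i , p∈S) = ≤-respʳ-≈ (zeroˡ _) (*-monoʳ-≤ (ℙ-nonNeg _) (≤-trans (below i p p∈i) (f≤0 p p∈S)))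
        ... | no cell∩S=∅         =
          ≤-reflexive (trans (*-congˡ (ℙ-null (cell i) λ p p∈i p∈S → cell∩S=∅ (p , p∈i , p∈S))) (zeroʳ _))

      -- Domination holds only on `S`, so each cell is cut by the support: the inner half gets the
      -- value divided by K, the outer half gets 0. The outer halves are null, so the lower sum is
      -- exactly divided by K.
      LowerSums-bounded : ∀ {f g} k → (∀ p → 0# ≤ g p) → (∀ p → p ∈ S → f p ≤ fromℕ (suc k) * g p) →
                          BoundedAbove (LowerSums η g) → BoundedAbove (LowerSums η f)
      LowerSums-bounded {f} {g} k 0≤g f≤Kg (M , ≤M) = K * M , bound
        where
        K = fromℕ (suc k)
        K*K⁻¹≈1 : K * K ⁻¹ ≈ 1#
        K*K⁻¹≈1 = *-inverseʳ K (fromℕ-suc≉0 k)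
        bound : UpperBound (LowerSums η f) (K * M)
        bound r (φ , r≈) = begin
          r                   ≈⟨ r≈ ⟩
          lowerSum η φ        ≈⟨ φ≈Kψ ⟩
          K * lowerSum η ψ    ≤⟨ *-monoˡ-≤ (fromℕ-nonNeg (suc k)) (≤M _ (ψ , refl)) ⟩
          K * M               ∎
          where
          open SimpleBelow φ
          open Split (partition φ) A
          values : Fin size ⊎ Fin size → Carrier
          values = [ (λ i → K ⁻¹ * value i) , (λ _ → 0#) ]′
          values≤g : ∀ x p → p ∈ ⟦ halves x ⟧ → values x ≤ g p
          values≤g (inj₁ i) p p∈ = begin
            K ⁻¹ * value i       ≤⟨ *-monoˡ-≤ (⁻¹-nonNeg (fromℕ-nonNeg (suc k)) (fromℕ-suc≉0 k))
                                      (≤-trans (below i p (∩-elimˡ {cell i} {A} p∈)) (f≤Kg p (A⊆S (∩-elimʳ {cell i} {A} p∈)))) ⟩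
            K ⁻¹ * (K * g p)     ≈⟨ solve 3 (λ x y z → x :* (y :* z) := y :* x :* z) refl (K ⁻¹) K (g p) ⟩
            K * K ⁻¹ * g p       ≈⟨ *-congʳ K*K⁻¹≈1 ⟩
            1# * g p             ≈⟨ *-identityˡ _ ⟩
            g p                  ∎
          values≤g (inj₂ i) p p∈ = 0≤g p
          ψ : SimpleBelow g
          ψ = simpleBelow split (values ∘ splitAt size) (λ i → values≤g (splitAt size i))
          φ≈Kψ : lowerSum η φ ≈ K * lowerSum η ψ
          φ≈Kψ = begin-equality
            ∑ (λ i → value i * ℙ (cell i))
              ≈⟨ ∑-cong term ⟩
            ∑ (λ i → K * (values (inj₁ i) * ℙ (halves (inj₁ i)) ))
              ≈⟨ *-distribˡ-∑ {size} K (λ i → values (inj₁ i) * ℙ (halves (inj₁ i))) ⟨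
            K * ∑ (λ i → values (inj₁ i) * ℙ (halves (inj₁ i)))
              ≈⟨ *-congˡ (+-identityʳ _) ⟨
            K * (∑ (λ i → values (inj₁ i) * ℙ (halves (inj₁ i))) + 0#)
              ≈⟨ *-congˡ (+-congˡ (∑-≈0 {size} λ _ → zeroˡ _)) ⟨
            K * (∑ (λ i → values (inj₁ i) * ℙ (halves (inj₁ i))) + ∑ (λ i → values (inj₂ i) * ℙ (halves (inj₂ i))))
              ≈⟨ *-congˡ (∑-splitAt size (λ x → values x * ℙ (halves x))) ⟨
            K * lowerSum η ψ ∎
            where
            term : ∀ i → value i * ℙ (cell i) ≈ K * (K ⁻¹ * value i * ℙ (cell i ∩ A))
            term i = begin-equality
              value i * ℙ (cell i)                                    ≈⟨ *-congˡ (ℙ-split (cell i) A) ⟩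
              value i * (ℙ (cell i ∩ A) + ℙ (cell i ∩ compl A))
                ≈⟨ *-congˡ (+-congˡ (ℙ-null _ λ p p∈ p∈S → ∩-elimʳ {cell i} {compl A} p∈ (S⊆A p∈S))) ⟩
              value i * (ℙ (cell i ∩ A) + 0#)
                ≈⟨ solve 2 (λ v x → v :* (x :+ # 0) := # 1 :* v :* x) refl (value i) _ ⟩
              1# * value i * ℙ (cell i ∩ A)                           ≈⟨ *-congʳ (*-congʳ K*K⁻¹≈1) ⟨
              K * K ⁻¹ * value i * ℙ (cell i ∩ A)
                ≈⟨ solve 4 (λ k l v x → k :* l :* v :* x := k :* (l :* v :* x)) refl K (K ⁻¹) (value i) _ ⟩
              K * (K ⁻¹ * value i * ℙ (cell i ∩ A))                   ∎

      -- The lower sum is at most the integral of the positive part, and the negative part, which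
      -- vanishes on `S`, has integral at most 0.
      lowerSum≤𝔼 : ∀ {f} → (∀ p → p ∈ S → 0# ≤ f p) → BoundedAbove (LowerSums η (λ p → f p ⁺)) →
                   (φ : SimpleBelow (λ p → f p ⁺)) → lowerSum η φ ≤ 𝔼 η f
      lowerSum≤𝔼 {f} 0≤f bdd φ = ≤-by
        (+-nonNeg (0≤y-x (sup-upper bdd _ (φ , refl)))
                  (0≤y-x (sup-≤0 λ r (ψ , r≈) → ≤-respˡ-≈ (sym r≈)
                    (lowerSum-nonPos (λ p p∈S → ⊔-lub (-f≤0 p p∈S) ≤-refl) ψ))))
        (solve 3 (λ x y z → x :- y := z :+ (x :- z :+ (# 0 :- y))) refl _ _ _)
        where
        -f≤0 : ∀ p → p ∈ S → - f p ≤ 0#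
        -f≤0 p p∈S = ≤-by (0≤f p p∈S) (solve 1 (λ x → # 0 := :- x :+ x) refl (f p))

-- Discretisation of the constraints.

module LowerBound (em : ExcludedMiddle 0ℓ) (ℝ : CompleteOrderedField) where

  open CompleteOrderedField ℝ
  open OrderedField ℝ
  open Kernel ℝ
  open Sums ℝ
  open Probability em ℝ
  open Integration em ℝ
  open ≤-Reasoning

  -- Unfolds to the function integrated in `Ψ`, so the bounds on `kernel` apply to it directly.
  integrand : Carrier → Point → Carrier
  integrand y p = kernel y 𝟏[ γ p ≤ y ] (lam p) (s p) (a p)

  𝟏∈[0,1] : ∀ P → UnitInterval 𝟏[ P ]
  𝟏∈[0,1] P with em {P}
  ... | yes _ = 1∈[0,1]
  ... | no _  = 0∈[0,1]

  -- The denominator satisfies 3 a - s ≥ 2 a > 0.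
  support-admissible : ∀ {p} → p ∈ Support → Admissible (lam p) (s p) (a p)
  support-admissible {p} (_ , (0≤s , s≤a , a≤1) , 0≤a , 0≉a) = record
    { 0≤l     = ⁻¹-nonNeg (≤-trans (*-nonNeg 0≤2 0≤a) 2a≤D) D≉0
    ; 0≤s     = 0≤s
    ; s≤a     = s≤a
    ; a≤1     = a≤1
    ; inverse = *-inverseʳ _ D≉0
    }
    where
    2a≤D : fromℕ 2 * a p ≤ fromℕ 3 * a p - s p
    2a≤D = ≤-by (0≤y-x s≤a) (solve 2 (λ s a → # 3 :* a :- s := # 2 :* a :+ (a :- s)) refl (s p) (a p))
    D≉0 : ¬ fromℕ 3 * a p - s p ≈ 0#
    D≉0 D≈0 = 0≉a (antisym 0≤a (fromℕ-cancelˡ-≤ 1 (≤-trans 2a≤D (≤-reflexive (trans D≈0 (sym (zeroʳ _)))))))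

  module _ (η : ProbabilityMeasure) (supported : SupportedOn η Support) (integrable : Integrable η lam) where

    open ProbabilityMeasure η
    open Measure η

    lowerSum≤Ψ : ∀ {y} → 0# ≤ y → (φ : SimpleBelow (λ p → integrand y p ⁺)) → lowerSum η φ ≤ Ψ η y
    lowerSum≤Ψ {y} 0≤y = lowerSum≤𝔼 supported
      (λ p p∈S → ≤-trans (Admissible.0≤l (support-admissible p∈S))
                         (Admissible.l≤kernel (support-admissible p∈S) y (proj₁ (𝟏∈[0,1] _))))
      -- `8` stands for the factor 9, which is passed as a predecessor.
      (LowerSums-bounded supported 8 (λ p → x≤y⊔x (lam p) 0#) integrand⁺≤9lam⁺ (proj₁ integrable))
      where
      integrand⁺≤9lam⁺ : ∀ p → p ∈ Support → integrand y p ⁺ ≤ fromℕ 9 * lam p ⁺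
      integrand⁺≤9lam⁺ p p∈S = ⊔-lub
        (begin
          integrand y p        ≤⟨ Admissible.kernel≤9l (support-admissible p∈S) 0≤y (𝟏∈[0,1] _) ⟩
          fromℕ 9 * lam p      ≤⟨ *-monoˡ-≤ (fromℕ-nonNeg 9) (x≤x⊔y _ _) ⟩
          fromℕ 9 * lam p ⁺    ∎)
        (*-nonNeg (fromℕ-nonNeg 9) (x≤y⊔x (lam p) 0#))

    -- The variables `τ`, `ρ`, `σ`, `h` stand for 1/10, 1/46, 1/6 and 1/N, each given by its
    -- defining equation.
    module Discretisation {τ ρ σ h : Carrier}
      (10τ≈1 : fromℕ 10 * τ ≈ 1#) (46ρ≈1 : fromℕ 46 * ρ ≈ 1#) (6σ≈1 : fromℕ 6 * σ ≈ 1#)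
      (N : ℕ) (Nh≈1 : fromℕ N * h ≈ 1#) (0≤h : 0# ≤ h) where

      y₁ y₂ : Carrier
      y₁ = fromℕ 7 * τ
      y₂ = fromℕ 9 * τ

      0≤τ : 0# ≤ τ
      0≤τ = reciprocal-nonNeg 9 10τ≈1

      0≤ρ : 0# ≤ ρ
      0≤ρ = reciprocal-nonNeg 45 46ρ≈1

      y₁∈[0,1] : UnitInterval y₁
      y₁∈[0,1] = fraction∈[0,1] 7 3 0≤τ 10τ≈1

      y₂∈[0,1] : UnitInterval y₂
      y₂∈[0,1] = fraction∈[0,1] 9 1 0≤τ 10τ≈1

      y₁≤y₂ : y₁ ≤ y₂
      y₁≤y₂ = *-monoʳ-≤ 0≤τ (≤-by 0≤2 (solve 0 (# 9 := # 7 :+ # 2) refl))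

      32ρ∈[0,1] : UnitInterval (fromℕ 32 * ρ)
      32ρ∈[0,1] = fraction∈[0,1] 32 14 0≤ρ 46ρ≈1

      5ρ∈[0,1] : UnitInterval (fromℕ 5 * ρ)
      5ρ∈[0,1] = fraction∈[0,1] 5 41 0≤ρ 46ρ≈1

      support : Borel
      support = proj₁ supported

      support⊆ : ⟦ support ⟧ ⊆ Support
      support⊆ = proj₁ (proj₁ (proj₂ supported))

      ⊆support : Support ⊆ ⟦ support ⟧
      ⊆support = proj₂ (proj₁ (proj₂ supported))

      -- The grid runs through both ends 0 and N h = 1, hence `suc N` points.
      s-cuts a-cuts cuts : List Borel
      s-cuts = applyUpTo (λ j → [s≤ fromℕ j * h ]) (suc N)
      a-cuts = applyUpTo (λ j → [a≤ fromℕ j * h ]) (suc N)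
      cuts   = support ∷ [γ≤ y₁ ] ∷ [γ≤ y₂ ] ∷ [a≤ σ ] ∷ s-cuts ++ a-cuts

      π : Partition
      π = refine cuts

      open Partition π

      -- The loss in `affine-within` for the tolerance 39 h.
      slack : Carrier
      slack = fromℕ 12 * (fromℕ 39 * h)

      0≤slack : 0# ≤ slack
      0≤slack = *-nonNeg (fromℕ-nonNeg 12) (*-nonNeg (fromℕ-nonNeg 39) 0≤h)

      target : Carrier
      target = fromℕ 9466 - fromℕ 5313 * slack

      target≤9466 : target ≤ fromℕ 9466
      target≤9466 = ≤-by (*-nonNeg (fromℕ-nonNeg 5313) 0≤slack) (solve 2 (λ x y → x := x :- y :+ y) refl _ _)

      -- The weighted combination of lower sums v₁, v₂, v₃ for Ψ and of m - y₁ m₁, m - y₂ m₂ for 1 - y F,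
      -- where 3880 = 1920 + 1960, 13440 = 7 · 1920 and 17640 = 9 · 1960.
      total : (v₁ v₂ v₃ m m₁ m₂ : Carrier) → Carrier
      total v₁ v₂ v₃ m m₁ m₂ = fromℕ 966 * v₁ + (fromℕ 1449 * v₂ + (fromℕ 2898 * v₃ + (fromℕ 3880 * m
        + (- (fromℕ 13440 * τ) * m₁ + - (fromℕ 17640 * τ) * m₂))))

      -- One cell's share of the combination. The traces on γ ≤ y are kept as probabilities so that
      -- summing over the cells produces `F`.
      record CellBound (c : Borel) : Set where
        field
          v₁ v₂ v₃ : Carrier
          below₁   : ∀ p → p ∈ ⟦ c ⟧ → v₁ ≤ integrand y₁ p ⁺
          below₂   : ∀ p → p ∈ ⟦ c ⟧ → v₂ ≤ integrand y₂ p ⁺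
          below₃   : ∀ p → p ∈ ⟦ c ⟧ → v₃ ≤ integrand 1# p ⁺
          bound    : target * ℙ c ≤ total (v₁ * ℙ c) (v₂ * ℙ c) (v₃ * ℙ c) (ℙ c) (ℙ (c ∩ [γ≤ y₁ ])) (ℙ (c ∩ [γ≤ y₂ ]))

      -- The value 0 is admissible because the integrands are truncated at 0, and both sides of the
      -- bound vanish.
      null-cell : ∀ c → ℙ c ≈ 0# → CellBound c
      null-cell c ℙc≈0 = record
        { v₁ = 0# ; v₂ = 0# ; v₃ = 0#
        ; below₁ = λ _ _ → x≤y⊔x _ 0# ; below₂ = λ _ _ → x≤y⊔x _ 0# ; below₃ = λ _ _ → x≤y⊔x _ 0#
        ; bound = ≤-reflexive (begin-equality
            target * ℙ c                 ≈⟨ *-congˡ ℙc≈0 ⟩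
            target * 0#
              ≈⟨ solve 2 (λ t τ → t :* # 0 := # 966 :* (# 0 :* # 0) :+ (# 1449 :* (# 0 :* # 0)
                  :+ (# 2898 :* (# 0 :* # 0)
                  :+ (# 3880 :* # 0 :+ (:- (# 13440 :* τ) :* # 0 :+ :- (# 17640 :* τ) :* # 0))))) refl target τ ⟩
            total (0# * 0#) (0# * 0#) (0# * 0#) 0# 0# 0#
              ≈⟨ +-cong (*-congˡ (*-congˡ ℙc≈0)) (+-cong (*-congˡ (*-congˡ ℙc≈0)) (+-cong (*-congˡ (*-congˡ ℙc≈0))
                   (+-cong (*-congˡ ℙc≈0) (+-cong (*-congˡ (ℙ∩≈0 _)) (*-congˡ (ℙ∩≈0 _)))))) ⟨
            total (0# * ℙ c) (0# * ℙ c) (0# * ℙ c) (ℙ c) (ℙ (c ∩ [γ≤ y₁ ])) (ℙ (c ∩ [γ≤ y₂ ])) ∎)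
        }
        where
        ℙ∩≈0 : ∀ B → ℙ (c ∩ B) ≈ 0#
        ℙ∩≈0 B = antisym (≤-respʳ-≈ ℙc≈0 (ℙ-mono _ _ (∩-elimˡ {c} {B}))) (ℙ-nonNeg _)

      -- On a cell decided by the cut at `y`, the indicator is a constant `i`, both inside the
      -- integrand and in the measure of the trace.
      record Indicator (y : Carrier) (c : Borel) (i : Carrier) : Set where
        field
          𝟏≈i   : ∀ p → p ∈ ⟦ c ⟧ → 𝟏[ γ p ≤ y ] ≈ i
          ℙ≈iℙ  : ℙ (c ∩ [γ≤ y ]) ≈ i * ℙ c

      indicator-inside : ∀ {y c} → ⟦ c ⟧ ⊆ ⟦ [γ≤ y ] ⟧ → Indicator y c 1#
      indicator-inside {y} {c} c⊆ = record
        { 𝟏≈i  = λ p p∈c → 𝟏-true (c⊆ p∈c)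
        ; ℙ≈iℙ = trans (ℙ-cong _ _ (∩-elimˡ {c} {[γ≤ y ]} ,
                   λ p∈c → ∩-intro {c} {[γ≤ y ]} p∈c (c⊆ p∈c))) (sym (*-identityˡ _))
        }

      indicator-outside : ∀ {y c} → ⟦ c ⟧ ⊆ ⟦ compl [γ≤ y ] ⟧ → Indicator y c 0#
      indicator-outside {y} {c} c⊆ = record
        { 𝟏≈i  = λ p p∈c → 𝟏-false (c⊆ p∈c)
        ; ℙ≈iℙ = trans (ℙ-empty _ λ p p∈ → c⊆ (∩-elimˡ {c} {[γ≤ y ]} p∈) (∩-elimʳ {c} {[γ≤ y ]} p∈)) (sym (zeroˡ _))
        }

      integrand-≈ : ∀ {y i p} → 𝟏[ γ p ≤ y ] ≈ i → kernel y i (lam p) (s p) (a p) ≈ integrand y p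
      integrand-≈ 𝟏≈i = sym (+-congʳ (+-congˡ (*-congˡ 𝟏≈i)))

      kernel⇒below : ∀ {y i p v} → 𝟏[ γ p ≤ y ] ≈ i → v ≤ kernel y i (lam p) (s p) (a p) → v ≤ integrand y p ⁺
      kernel⇒below 𝟏≈i v≤ = ≤-trans v≤ (≤-trans (≤-reflexive (integrand-≈ 𝟏≈i)) (x≤x⊔y _ _))

      module _ {c : Borel} (c⊆ : ⟦ c ⟧ ⊆ Support) where

        𝟏-at-1 : ∀ p → p ∈ ⟦ c ⟧ → 𝟏[ γ p ≤ 1# ] ≈ 1#
        𝟏-at-1 p p∈c = 𝟏-true (proj₂ (proj₁ (c⊆ p∈c)))

        cellBound : ∀ {i₁ i₂ v₁ v₂ v₃} → Indicator y₁ c i₁ → Indicator y₂ c i₂ →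
                    (∀ p → p ∈ ⟦ c ⟧ → v₁ ≤ kernel y₁ i₁ (lam p) (s p) (a p)) →
                    (∀ p → p ∈ ⟦ c ⟧ → v₂ ≤ kernel y₂ i₂ (lam p) (s p) (a p)) →
                    (∀ p → p ∈ ⟦ c ⟧ → v₃ ≤ kernel 1# 1# (lam p) (s p) (a p)) →
                    target ≤ weighted τ v₁ v₂ v₃ i₁ i₂ → CellBound c
        cellBound {i₁} {i₂} {v₁} {v₂} {v₃} I₁ I₂ below₁ below₂ below₃ target≤ = record
          { v₁ = v₁ ; v₂ = v₂ ; v₃ = v₃
          ; below₁ = λ p p∈c → kernel⇒below (Indicator.𝟏≈i I₁ p p∈c) (below₁ p p∈c)
          ; below₂ = λ p p∈c → kernel⇒below (Indicator.𝟏≈i I₂ p p∈c) (below₂ p p∈c)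
          ; below₃ = λ p p∈c → kernel⇒below (𝟏-at-1 p p∈c) (below₃ p p∈c)
          ; bound  = begin
              target * ℙ c
                ≤⟨ *-monoʳ-≤ (ℙ-nonNeg c) target≤ ⟩
              weighted τ v₁ v₂ v₃ i₁ i₂ * ℙ c
                ≈⟨ solve 7 (λ v₁ v₂ v₃ i₁ i₂ τ m →
                     (# 966 :* v₁ :+ # 1449 :* v₂ :+ # 2898 :* v₃
                       :+ # 1920 :* (# 1 :- # 7 :* τ :* i₁) :+ # 1960 :* (# 1 :- # 9 :* τ :* i₂)) :* m :=
                     # 966 :* (v₁ :* m) :+ (# 1449 :* (v₂ :* m) :+ (# 2898 :* (v₃ :* m) :+ (# 3880 :* m
                       :+ (:- (# 13440 :* τ) :* (i₁ :* m) :+ :- (# 17640 :* τ) :* (i₂ :* m))))))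
                     refl v₁ v₂ v₃ i₁ i₂ τ (ℙ c) ⟩
              total (v₁ * ℙ c) (v₂ * ℙ c) (v₃ * ℙ c) (ℙ c) (i₁ * ℙ c) (i₂ * ℙ c)
                ≈⟨ +-congˡ (+-congˡ (+-congˡ (+-congˡ (+-cong (*-congˡ (Indicator.ℙ≈iℙ I₁)) (*-congˡ (Indicator.ℙ≈iℙ I₂)))))) ⟨
              total (v₁ * ℙ c) (v₂ * ℙ c) (v₃ * ℙ c) (ℙ c) (ℙ (c ∩ [γ≤ y₁ ])) (ℙ (c ∩ [γ≤ y₂ ])) ∎
          }

        -- The constant 2 is a valid value for all three integrands, so the size of the mesh does
        -- not enter.
        small-a-cell : ∀ {i₁ i₂} → UnitInterval i₁ → UnitInterval i₂ → Indicator y₁ c i₁ → Indicator y₂ c i₂ →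
                       (∀ p → p ∈ ⟦ c ⟧ → fromℕ 6 * a p ≤ 1#) → CellBound c
        small-a-cell i₁∈ i₂∈ I₁ I₂ 6a≤1 =
          cellBound I₁ I₂ (below (proj₁ i₁∈)) (below (proj₁ i₂∈)) (below 0≤1)
            (≤-trans target≤9466 (certificate₀ 10τ≈1 46ρ≈1 i₁∈ i₂∈))
          where
          below : ∀ {y i} → 0# ≤ i → ∀ p → p ∈ ⟦ c ⟧ → fromℕ 2 ≤ kernel y i (lam p) (s p) (a p)
          below {y} 0≤i p p∈c = ≤-trans (Admissible.2≤l A (6a≤1 p p∈c)) (Admissible.l≤kernel A y 0≤i)
            where A = support-admissible (c⊆ p∈c)

        -- The certificate is applied at the base point `q`. Lowering the minorants there by `slack`
        -- makes them valid on the whole cell, at a total cost of 5313 `slack`.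
        large-a-cell : ∀ {i₁ i₂ θ₁ θ₂} → UnitInterval i₁ → UnitInterval i₂ → UnitInterval θ₁ → UnitInterval θ₂ →
                       Indicator y₁ c i₁ → Indicator y₂ c i₂ →
                       (∀ p → p ∈ ⟦ c ⟧ → 1# ≤ fromℕ 6 * a p) →
                       (∀ p q → p ∈ ⟦ c ⟧ → q ∈ ⟦ c ⟧ → s p ≤ s q + h × a p ≤ a q + h) →
                       (∀ {l u} → u ≤ l → fromℕ 9466 ≤ weighted τ
                         (lowerʸ y₁ i₁ θ₁ l u) (lowerʸ y₂ i₂ θ₂ l u) (lowerᵃ l u) i₁ i₂) →
                       ∀ q → q ∈ ⟦ c ⟧ → CellBound c
        large-a-cell {i₁} {i₂} {θ₁} {θ₂} i₁∈ i₂∈ θ₁∈ θ₂∈ I₁ I₂ 1≤6a near certificate q q∈c =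
          cellBound I₁ I₂ (λ p p∈c → belowʸ p p∈c y₁∈[0,1] i₁∈ θ₁∈)
            (λ p p∈c → belowʸ p p∈c y₂∈[0,1] i₂∈ θ₂∈) belowᵃ (begin
            fromℕ 9466 - fromℕ 5313 * slack      ≤⟨ +-monoˡ-≤ _ (certificate (Admissible.l*a≤l Q)) ⟩
            weighted τ (lowerʸ y₁ i₁ θ₁ l u) (lowerʸ y₂ i₂ θ₂ l u) (lowerᵃ l u) i₁ i₂ - fromℕ 5313 * slack
              ≈⟨ weighted-shift slack ⟨
            weighted τ (lowerʸ y₁ i₁ θ₁ l u - slack) (lowerʸ y₂ i₂ θ₂ l u - slack) (lowerᵃ l u - slack) i₁ i₂ ∎)
          where
          Q = support-admissible (c⊆ q∈c)
          l = lam q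
          u = lam q * a q
          module _ (p : Point) (p∈c : p ∈ ⟦ c ⟧) where
            P = support-admissible (c⊆ p∈c)
            pq = near p q p∈c q∈c
            qp = near q p q∈c p∈c
            -- Gives l the same tolerance 39 h as l a.
            weaken : ∀ x → x + fromℕ 36 * h ≤ x + fromℕ 39 * h
            weaken x = ≤-by (*-nonNeg (fromℕ-nonNeg 3) 0≤h)
              (solve 2 (λ x h → x :+ # 39 :* h := x :+ # 36 :* h :+ # 3 :* h) refl x h)
            l~ : Within (fromℕ 39 * h) l (lam p)
            l~ = ≤-trans (l-within Q P (1≤6a q q∈c) (1≤6a p p∈c) 0≤h (proj₂ pq) (proj₁ qp)) (weaken _)
               , ≤-trans (l-within P Q (1≤6a p p∈c) (1≤6a q q∈c) 0≤h (proj₂ qp) (proj₁ pq)) (weaken _)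
            u~ : Within (fromℕ 39 * h) u (lam p * a p)
            u~ = la-within Q P (1≤6a q q∈c) (1≤6a p p∈c) 0≤h (proj₂ qp) (proj₂ pq) (proj₁ qp)
               , la-within P Q (1≤6a p p∈c) (1≤6a q q∈c) 0≤h (proj₂ pq) (proj₂ qp) (proj₁ pq)
            belowʸ : ∀ {y i θ} → UnitInterval y → UnitInterval i → UnitInterval θ →
                     lowerʸ y i θ l u - slack ≤ kernel y i (lam p) (s p) (a p)
            belowʸ y∈ i∈ θ∈ = let c₁≤6 , c₂≤6 = lowerʸ-slopes y∈ i∈ θ∈ in
              ≤-trans (affine-within c₁≤6 c₂≤6 l~ u~) (Admissible.kernel-lowerʸ P (proj₁ i∈) θ∈)
            belowᵃ : lowerᵃ l u - slack ≤ kernel 1# 1# (lam p) (s p) (a p)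
            belowᵃ = ≤-trans (affine-within (proj₁ lowerᵃ-slopes) (proj₂ lowerᵃ-slopes) l~ u~) (Admissible.kernel-lowerᵃ P)

      support∈cuts : support ∈ˡ cuts
      support∈cuts = here ≡.refl

      γ₁∈cuts : [γ≤ y₁ ] ∈ˡ cuts
      γ₁∈cuts = there (here ≡.refl)

      γ₂∈cuts : [γ≤ y₂ ] ∈ˡ cuts
      γ₂∈cuts = there (there (here ≡.refl))

      σ∈cuts : [a≤ σ ] ∈ˡ cuts
      σ∈cuts = there (there (there (here ≡.refl)))

      s∈cuts : ∀ j → j ℕ.≤ N → [s≤ fromℕ j * h ] ∈ˡ cuts
      s∈cuts j j≤N = there (there (there (there (∈-++⁺ˡ (∈-applyUpTo⁺ (λ j → [s≤ fromℕ j * h ]) (ℕ.s≤s j≤N))))))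

      a∈cuts : ∀ j → j ℕ.≤ N → [a≤ fromℕ j * h ] ∈ˡ cuts
      a∈cuts j j≤N = there (there (there (there (∈-++⁺ʳ s-cuts (∈-applyUpTo⁺ (λ j → [a≤ fromℕ j * h ]) (ℕ.s≤s j≤N))))))

      same-side : ∀ {B} → B ∈ˡ cuts → ∀ i {p q} → p ∈ ⟦ cell i ⟧ → q ∈ ⟦ cell i ⟧ → q ∈ ⟦ B ⟧ → p ∈ ⟦ B ⟧
      same-side B∈ i p∈i q∈i q∈B with refine-decides cuts B∈ i
      ... | inj₁ i⊆B  = i⊆B p∈i
      ... | inj₂ i⊆Bᶜ = contradiction q∈B (i⊆Bᶜ q∈i)

      cell-near : ∀ i → ⟦ cell i ⟧ ⊆ Support → ∀ p q → p ∈ ⟦ cell i ⟧ → q ∈ ⟦ cell i ⟧ → s p ≤ s q + h × a p ≤ a q + h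
      cell-near i i⊆S p q p∈i q∈i =
          grid-≤ 0≤h Q.0≤s N (≤1⇒≤Nh (≤-trans Q.s≤a Q.a≤1)) (λ j j≤N → same-side (s∈cuts j j≤N) i p∈i q∈i)
        , grid-≤ 0≤h Q.0≤a N (≤1⇒≤Nh Q.a≤1) (λ j j≤N → same-side (a∈cuts j j≤N) i p∈i q∈i)
        where
        module Q = Admissible (support-admissible (i⊆S q∈i))
        ≤1⇒≤Nh : ∀ {x} → x ≤ 1# → x ≤ fromℕ N * h
        ≤1⇒≤Nh = ≤-respʳ-≈ (sym Nh≈1)

      6a≤1 : ∀ {p} → a p ≤ σ → fromℕ 6 * a p ≤ 1#
      6a≤1 a≤σ = ≤-respʳ-≈ 6σ≈1 (*-monoˡ-≤ (fromℕ-nonNeg 6) a≤σ)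

      1≤6a : ∀ {p} → ¬ a p ≤ σ → 1# ≤ fromℕ 6 * a p
      1≤6a {p} a≰σ with ≤-total σ (a p)
      ... | inj₁ σ≤a = ≤-respˡ-≈ 6σ≈1 (*-monoˡ-≤ (fromℕ-nonNeg 6) σ≤a)
      ... | inj₂ a≤σ = contradiction a≤σ a≰σ

      inhabited-cell : ∀ i → ⟦ cell i ⟧ ⊆ Support → ∀ q → q ∈ ⟦ cell i ⟧ → CellBound (cell i)
      inhabited-cell i i⊆S q q∈i
        with refine-decides cuts γ₁∈cuts i | refine-decides cuts γ₂∈cuts i | refine-decides cuts σ∈cuts i
      -- The base point would satisfy γ ≤ y₁ ≤ y₂ < γ.
      ... | inj₁ γ≤y₁ | inj₂ γ>y₂ | _ = contradiction (≤-trans (γ≤y₁ q∈i) y₁≤y₂) (γ>y₂ q∈i)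
      ... | inj₁ γ≤y₁ | inj₁ γ≤y₂ | inj₁ a≤σ =
        small-a-cell i⊆S 1∈[0,1] 1∈[0,1] (indicator-inside γ≤y₁) (indicator-inside γ≤y₂) (λ p p∈i → 6a≤1 {p} (a≤σ p∈i))
      ... | inj₂ γ>y₁ | inj₁ γ≤y₂ | inj₁ a≤σ =
        small-a-cell i⊆S 0∈[0,1] 1∈[0,1] (indicator-outside γ>y₁) (indicator-inside γ≤y₂) (λ p p∈i → 6a≤1 {p} (a≤σ p∈i))
      ... | inj₂ γ>y₁ | inj₂ γ>y₂ | inj₁ a≤σ =
        small-a-cell i⊆S 0∈[0,1] 0∈[0,1] (indicator-outside γ>y₁) (indicator-outside γ>y₂) (λ p p∈i → 6a≤1 {p} (a≤σ p∈i))
      ... | inj₁ γ≤y₁ | inj₁ γ≤y₂ | inj₂ a>σ =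
        large-a-cell i⊆S 1∈[0,1] 1∈[0,1] 1∈[0,1] 0∈[0,1] (indicator-inside γ≤y₁) (indicator-inside γ≤y₂)
          (λ p p∈i → 1≤6a {p} (a>σ p∈i)) (cell-near i i⊆S) (λ {l} {u} _ → certificate₁ 10τ≈1 46ρ≈1 l u) q q∈i
      ... | inj₂ γ>y₁ | inj₁ γ≤y₂ | inj₂ a>σ =
        large-a-cell i⊆S 0∈[0,1] 1∈[0,1] 32ρ∈[0,1] 0∈[0,1] (indicator-outside γ>y₁) (indicator-inside γ≤y₂)
          (λ p p∈i → 1≤6a {p} (a>σ p∈i)) (cell-near i i⊆S) (certificate₂ 10τ≈1 46ρ≈1) q q∈i
      ... | inj₂ γ>y₁ | inj₂ γ>y₂ | inj₂ a>σ =
        large-a-cell i⊆S 0∈[0,1] 0∈[0,1] 5ρ∈[0,1] 0∈[0,1] (indicator-outside γ>y₁) (indicator-outside γ>y₂)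
          (λ p p∈i → 1≤6a {p} (a>σ p∈i)) (cell-near i i⊆S) (certificate₃ 10τ≈1 46ρ≈1) q q∈i

      every-cell : ∀ i → CellBound (cell i)
      every-cell i with refine-decides cuts support∈cuts i | em {∃ λ q → q ∈ ⟦ cell i ⟧}
      ... | inj₁ i⊆S | yes (q , q∈i) = inhabited-cell i (λ p∈i → support⊆ (i⊆S p∈i)) q q∈i
      ... | inj₁ _   | no empty      = null-cell (cell i) (ℙ-empty (cell i) λ p p∈i → empty (p , p∈i))
      ... | inj₂ i⊆Sᶜ | _            = null-cell (cell i) (ℙ-null supported (cell i) λ p p∈i p∈S → i⊆Sᶜ p∈i (⊆support p∈S))

      -- Since `total` is nested to the right, linearity is applied to one summand at a time.
      ∑-total : ∀ {n} (v₁ v₂ v₃ m m₁ m₂ : Fin n → Carrier) →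
                ∑ (λ i → total (v₁ i) (v₂ i) (v₃ i) (m i) (m₁ i) (m₂ i)) ≈ total (∑ v₁) (∑ v₂) (∑ v₃) (∑ m) (∑ m₁) (∑ m₂)
      ∑-total {n} v₁ v₂ v₃ m m₁ m₂ =
        step v₁ _ (step v₂ _ (step v₃ _ (step m _ (step m₁ _ (sym (*-distribˡ-∑ _ m₂))))))
        where
        step : ∀ {k x} (f g : Fin n → Carrier) → ∑ g ≈ x → ∑ (λ i → k * f i + g i) ≈ k * ∑ f + x
        step {k} f g ∑g≈x = trans (∑-distrib-+ (λ i → k * f i) g) (+-cong (sym (*-distribˡ-∑ k f)) ∑g≈x)

      module _ {β : Carrier} (constraints : ∀ y → 0# ≤ y → y ≤ 1# → Ψ η y ≤ β × 1# - y * F η y ≤ β * (1# - y)) where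

        -- Sums the cell bounds and then applies the five constraints. The final coefficient is 6085
        -- = 5313 + 1920 · 3/10 + 1960 · 1/10.
        discrete-bound : target ≤ fromℕ 6085 * β
        discrete-bound = begin
          target
            ≈⟨ *-identityʳ target ⟨
          target * 1#
            ≈⟨ *-congˡ (∑-ℙ-cell π) ⟨
          target * ∑ (ℙ ∘ cell)
            ≈⟨ *-distribˡ-∑ target (ℙ ∘ cell) ⟩
          ∑ (λ i → target * ℙ (cell i))
            ≤⟨ ∑-mono-≤ (λ i → CellBound.bound (every-cell i)) ⟩
          ∑ (λ i → total (v₁ i * ℙ (cell i)) (v₂ i * ℙ (cell i)) (v₃ i * ℙ (cell i)) (ℙ (cell i))
                     (ℙ (cell i ∩ [γ≤ y₁ ])) (ℙ (cell i ∩ [γ≤ y₂ ])))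
            ≈⟨ ∑-total (λ i → v₁ i * ℙ (cell i)) (λ i → v₂ i * ℙ (cell i)) (λ i → v₃ i * ℙ (cell i)) (ℙ ∘ cell) _ _ ⟩
          total (lowerSum η φ₁) (lowerSum η φ₂) (lowerSum η φ₃) (∑ (ℙ ∘ cell))
                (∑ (λ i → ℙ (cell i ∩ [γ≤ y₁ ]))) (∑ (λ i → ℙ (cell i ∩ [γ≤ y₂ ])))
            ≈⟨ +-congˡ (+-congˡ (+-congˡ (+-cong (*-congˡ (∑-ℙ-cell π))
                 (+-cong (*-congˡ (∑-ℙ-cell-∩ π _)) (*-congˡ (∑-ℙ-cell-∩ π _)))))) ⟩
          total (lowerSum η φ₁) (lowerSum η φ₂) (lowerSum η φ₃) 1# (F η y₁) (F η y₂)
            -- The gap is the sum of the gaps in the five constraints, each with its weight.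
            ≤⟨ ≤-by
                 (+-nonNeg (*-nonNeg (fromℕ-nonNeg 966) (0≤y-x (Ψ-bound y₁∈[0,1] φ₁)))
                 (+-nonNeg (*-nonNeg (fromℕ-nonNeg 1449) (0≤y-x (Ψ-bound y₂∈[0,1] φ₂)))
                 (+-nonNeg (*-nonNeg (fromℕ-nonNeg 2898) (0≤y-x (Ψ-bound 1∈[0,1] φ₃)))
                 (+-nonNeg (*-nonNeg (fromℕ-nonNeg 1920) (0≤y-x (F-bound y₁∈[0,1])))
                           (*-nonNeg (fromℕ-nonNeg 1960) (0≤y-x (F-bound y₂∈[0,1])))))))
                 (solve 7 (λ β τ L₁ L₂ L₃ F₁ F₂ →
                   # 5313 :* β :+ # 1920 :* (β :* (# 1 :- # 7 :* τ)) :+ # 1960 :* (β :* (# 1 :- # 9 :* τ)) :=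
                   # 966 :* L₁ :+ (# 1449 :* L₂ :+ (# 2898 :* L₃ :+ (# 3880 :* # 1
                       :+ (:- (# 13440 :* τ) :* F₁ :+ :- (# 17640 :* τ) :* F₂))))
                   :+ (# 966 :* (β :- L₁) :+ (# 1449 :* (β :- L₂) :+ (# 2898 :* (β :- L₃)
                       :+ (# 1920 :* (β :* (# 1 :- # 7 :* τ) :- (# 1 :- # 7 :* τ :* F₁))
                       :+ # 1960 :* (β :* (# 1 :- # 9 :* τ) :- (# 1 :- # 9 :* τ :* F₂)))))))
                   refl β τ (lowerSum η φ₁) (lowerSum η φ₂) (lowerSum η φ₃) (F η y₁) (F η y₂)) ⟩
          -- 9193 is the sum of all five weights, and 3108 = (13440 + 17640) / 10 collects the terms
          -- in `τ`.
          fromℕ 5313 * β + fromℕ 1920 * (β * (1# - y₁)) + fromℕ 1960 * (β * (1# - y₂))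
            ≈⟨ solve 2 (λ β τ → # 5313 :* β :+ # 1920 :* (β :* (# 1 :- # 7 :* τ)) :+ # 1960 :* (β :* (# 1 :- # 9 :* τ)) :=
                 # 9193 :* β :- # 3108 :* β :* (# 10 :* τ)) refl β τ ⟩
          fromℕ 9193 * β - fromℕ 3108 * β * (fromℕ 10 * τ)
            ≈⟨ +-congˡ (-‿cong (*-congˡ 10τ≈1)) ⟩
          fromℕ 9193 * β - fromℕ 3108 * β * 1#
            ≈⟨ solve 1 (λ β → # 9193 :* β :- # 3108 :* β :* # 1 := # 6085 :* β) refl β ⟩
          fromℕ 6085 * β ∎
          where
          v₁ v₂ v₃ : Fin size → Carrier
          v₁ = CellBound.v₁ ∘ every-cell
          v₂ = CellBound.v₂ ∘ every-cell
          v₃ = CellBound.v₃ ∘ every-cell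
          φ₁ : SimpleBelow (λ p → integrand y₁ p ⁺)
          φ₁ = simpleBelow π v₁ (CellBound.below₁ ∘ every-cell)
          φ₂ : SimpleBelow (λ p → integrand y₂ p ⁺)
          φ₂ = simpleBelow π v₂ (CellBound.below₂ ∘ every-cell)
          φ₃ : SimpleBelow (λ p → integrand 1# p ⁺)
          φ₃ = simpleBelow π v₃ (CellBound.below₃ ∘ every-cell)
          Ψ-bound : ∀ {y} → UnitInterval y → (φ : SimpleBelow (λ p → integrand y p ⁺)) → lowerSum η φ ≤ β
          Ψ-bound (0≤y , y≤1) φ = ≤-trans (lowerSum≤Ψ 0≤y φ) (proj₁ (constraints _ 0≤y y≤1))
          F-bound : ∀ {y} → UnitInterval y → 1# - y * F η y ≤ β * (1# - y)
          F-bound (0≤y , y≤1) = proj₂ (constraints _ 0≤y y≤1)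

-- Choice of the mesh and comparison with the claimed constant.

mainTheorem3 : (em : ExcludedMiddle 0ℓ) (ℝ : CompleteOrderedField) →
    let open CompleteOrderedField ℝ
        open Probability em ℝ
    in
    (η : ProbabilityMeasure) →
    SupportedOn η Support →
    Integrable η lam →
    (β : Carrier) →
    (∀ y → 0# ≤ y → y ≤ 1# → Ψ η y ≤ β × 1# - y * F η y ≤ β * (1# - y)) →
    fromℕ 196969687 * fromℕ 126617839 ⁻¹ ≤ β
mainTheorem3 em ℝ η supported integrable β constraints = fromℕ-cancelˡ-≤ 126617838 (fromℕ-cancelˡ-≤ 6084 (begin
    fromℕ 6085 * (fromℕ 126617839 * (fromℕ 196969687 * D⁻¹))
      ≈⟨ solve 1 (λ x → # 6085 :* (# 126617839 :* (# 196969687 :* x)) :=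
                         # 6085 :* # 196969687 :* (# 126617839 :* x)) refl D⁻¹ ⟩
    fromℕ 6085 * fromℕ 196969687 * (fromℕ 126617839 * D⁻¹)
      ≈⟨ *-congˡ (inverse 126617838) ⟩
    fromℕ 6085 * fromℕ 196969687 * 1#
      -- 3918579 = 126617839 · 9466 - 6085 · 196969687 is the numerical surplus. Rewritten as a
      -- multiple of `h`, it exceeds the mesh loss 126617839 · 5313 · 12 · 39 h by the stated
      -- amount.
      ≤⟨ ≤-by (*-nonNeg (fromℕ-nonNeg 3603745769211924) 0≤h) (begin-equality
             fromℕ 126617839 * target
               ≈⟨ solve 1 (λ h → # 126617839 :* (# 9466 :- # 5313 :* (# 12 :* (# 39 :* h))) :=
                    # 6085 :* # 196969687 :* # 1 :+ (# 3918579 :- # 314833230788076 :* h)) refl h ⟩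
             fromℕ 6085 * fromℕ 196969687 * 1# + (fromℕ 3918579 - fromℕ 314833230788076 * h)
               ≈⟨ +-congˡ (+-congʳ (trans (*-congˡ (inverse 999999999)) (*-identityʳ _))) ⟨
             fromℕ 6085 * fromℕ 196969687 * 1# + (fromℕ 3918579 * (fromℕ 1000000000 * h) - fromℕ 314833230788076 * h)
               ≈⟨ +-congˡ (solve 1 (λ h → # 3918579 :* (# 1000000000 :* h) :- # 314833230788076 :* h := # 3603745769211924 :* h) refl h) ⟩
             fromℕ 6085 * fromℕ 196969687 * 1# + fromℕ 3603745769211924 * h ∎) ⟩
    fromℕ 126617839 * target
      ≤⟨ *-monoˡ-≤ (fromℕ-nonNeg 126617839) (discrete-bound constraints) ⟩
    fromℕ 126617839 * (fromℕ 6085 * β)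
      ≈⟨ solve 1 (λ x → # 126617839 :* (# 6085 :* x) := # 6085 :* (# 126617839 :* x)) refl β ⟩
    fromℕ 6085 * (fromℕ 126617839 * β) ∎))
  where
  open CompleteOrderedField ℝ
  open OrderedField ℝ
  open ≤-Reasoning
  D⁻¹ h : Carrier
  D⁻¹ = fromℕ 126617839 ⁻¹
  -- The mesh leaves 9466 - 5313 · 12 · 39 · h above 6085 times the claimed constant.
  h   = fromℕ 1000000000 ⁻¹
  inverse : ∀ n → fromℕ (suc n) * fromℕ (suc n) ⁻¹ ≈ 1#
  inverse n = *-inverseʳ _ (fromℕ-suc≉0 n)
  0≤h : 0# ≤ h
  0≤h = ⁻¹-nonNeg (fromℕ-nonNeg 1000000000) (fromℕ-suc≉0 999999999)
  open LowerBound.Discretisation em ℝ η supported integrable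
    (inverse 9) (inverse 45) (inverse 5) 1000000000 (inverse 999999999) 0≤h
    using (target; discrete-bound)
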